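{- Let $n,m$ be positive integers with $\mathfrak{B}_{n,m}\neq\emptyset$. Every bipartite optimal graph in $\mathfrak{B}_{n,m}$ is a difference graph.
   Context: All graphs are finite, simple and undirected. For a graph $G$ on $n$ vertices with adjacency matrix $\mathbf{A}(G)$, write $\det(\lambda I-\mathbf{A}(G))=\sum_{i=0}^n \mathbf{a}_i(G)\lambda^{n-i}$, so $\mathbf{a}_4(G)$ is the coefficient of $\lambda^{n-4}$. $\mathfrak{B}_{n,m}$ denotes the set of all connected bipartite graphs with $n$ vertices and $m$ edges. A graph $G\in\mathfrak{B}_{n,m}$ is called bipartite optimal if $\mathbf{a}_4(G)=\min\{\mathbf{a}_4(H): H\in\mathfrak{B}_{n,m}\}$. A graph $G$ is a difference graph if there exist a real $t$ and a function $w:V(G)\to\mathbb{R}$ with $|w(v)|<t$ for all $v$, such that distinct vertices $u,v$ are adjacent if and only if $|w(u)-w(v)|\ge t$ (equivalently, $G$ is bipartite and the neighborhoods of the vertices in one of the partite sets are linearly ordered by inclusion). -}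

module Defs where

open import Data.Nat as ℕ using (ℕ; zero; suc)
open import Data.Fin as Fin using (Fin; zero; suc; toℕ; punchIn)
open import Data.Bool using (Bool; true; false; if_then_else_; T)
open import Data.List using (List; []; _∷_; map)
open import Data.Integer as ℤ using (ℤ; +_; -_)
open import Data.Product using (Σ; _×_; _,_; ∃)
open import Relation.Binary.PropositionalEquality using (_≡_; _≢_)
open import Relation.Nullary using (¬_; does)
open import Data.Rational as ℚ using (ℚ)

record Graph (n : ℕ) : Set where
  field
    adj    : Fin n → Fin n → Bool
    sym    : ∀ u v → adj u v ≡ adj v u
    irrefl : ∀ u → adj u u ≡ false
open Graph public

Adj : ∀ {n} → Graph n → Fin n → Fin n → Set
Adj G u v = T (adj G u v)

sumFin : ∀ k → (Fin k → ℕ) → ℕ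
sumFin zero    f = 0
sumFin (suc k) f = f zero ℕ.+ sumFin k (λ i → f (suc i))

edgeCount : ∀ {n} → Graph n → ℕ
edgeCount {n} G =
  sumFin n (λ u → sumFin n (λ v →
    if adj G u v then (if does (toℕ u ℕ.<? toℕ v) then 1 else 0) else 0))

data Reach {n} (G : Graph n) : Fin n → Fin n → Set where
  here : ∀ {u} → Reach G u u
  step : ∀ {u w v} → Adj G u w → Reach G w v → Reach G u v

Connected : ∀ {n} → Graph n → Set
Connected {n} G = ∀ (u v : Fin n) → Reach G u v

Bipartite : ∀ {n} → Graph n → Set
Bipartite {n} G = Σ (Fin n → Bool) λ c → ∀ u v → Adj G u v → c u ≢ c v

InB : (n m : ℕ) → Graph n → Set
InB n m G = Connected G × Bipartite G × edgeCount G ≡ m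

-- Polynomials with integer coefficients, little-endian coefficient lists
-- (index k = coefficient of λ^k)

Poly : Set
Poly = List ℤ

infixl 6 _+ₚ_
_+ₚ_ : Poly → Poly → Poly
[]      +ₚ q       = q
(a ∷ p) +ₚ []      = a ∷ p
(a ∷ p) +ₚ (b ∷ q) = (a ℤ.+ b) ∷ (p +ₚ q)

scaleₚ : ℤ → Poly → Poly
scaleₚ a p = map (a ℤ.*_) p

infixl 7 _*ₚ_
_*ₚ_ : Poly → Poly → Poly
[]      *ₚ q = []
(a ∷ p) *ₚ q = scaleₚ a q +ₚ (ℤ.0ℤ ∷ (p *ₚ q))

negₚ : Poly → Poly
negₚ = scaleₚ (- ℤ.1ℤ)

coeff : ℕ → Poly → ℤ
coeff k       []      = ℤ.0ℤ
coeff zero    (a ∷ p) = a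
coeff (suc k) (a ∷ p) = coeff k p

sumPoly : ∀ k → (Fin k → Poly) → Poly
sumPoly zero    f = []
sumPoly (suc k) f = f zero +ₚ sumPoly k (λ i → f (suc i))

signℤ : ℕ → ℤ
signℤ zero          = ℤ.1ℤ
signℤ (suc zero)    = - ℤ.1ℤ
signℤ (suc (suc k)) = signℤ k

det : ∀ n → (Fin n → Fin n → Poly) → Poly
det zero    M = ℤ.1ℤ ∷ []
det (suc n) M = sumPoly (suc n) (λ j →
  scaleₚ (signℤ (toℕ j)) (M zero j *ₚ det n (λ r c → M (suc r) (punchIn j c))))

adjℤ : ∀ {n} → Graph n → Fin n → Fin n → ℤ
adjℤ G u v = if adj G u v then ℤ.1ℤ else ℤ.0ℤ

charPoly : ∀ {n} → Graph n → Poly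
charPoly {n} G = det n (λ i j →
  (if does (i Fin.≟ j) then ℤ.0ℤ ∷ ℤ.1ℤ ∷ [] else [])
    +ₚ (- adjℤ G i j ∷ []))

aCoeff : ℕ → ∀ {n} → Graph n → ℤ
aCoeff i {n} G = if does (i ℕ.≤? n) then coeff (n ℕ.∸ i) (charPoly G) else ℤ.0ℤ

a₄ : ∀ {n} → Graph n → ℤ
a₄ = aCoeff 4

BipartiteOptimal : (n m : ℕ) → Graph n → Set
BipartiteOptimal n m G = InB n m G × (∀ (H : Graph n) → InB n m H → a₄ G ℤ.≤ a₄ H)

-- difference graph (threshold/weight definition; weights taken rational)
DifferenceGraph : ∀ {n} → Graph n → Set
DifferenceGraph {n} G =
  Σ ℚ λ t → Σ (Fin n → ℚ) λ w →
    (∀ v → ℚ.∣ w v ∣ ℚ.< t) ×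
    (∀ u v → u ≢ v → (Adj G u v → t ℚ.≤ ℚ.∣ w u ℚ.- w v ∣) × (t ℚ.≤ ℚ.∣ w u ℚ.- w v ∣ → Adj G u v))

-- For every graph, 24 a₄ + 6 tr A⁴ = 3 (tr A²)²: a₄ is the sum of the principal 4-minors of -A, and
-- 24 times that sum is a sum over all 4-tuples of vertices. As tr A² = 2m, minimising a₄ means
-- maximising tr A⁴, which for a bipartite graph is twice ∑ |N(x) ∩ N(w)|² over the vertices x, w of
-- one class. If u and v have a common neighbour and incomparable neighbourhoods, replacing N(u), N(v)
-- by N(u) ∩ N(v), N(u) ∪ N(v) keeps the graph connected and bipartite, keeps m, and increases that sum:
-- |N(u) ∩ W|² + |N(v) ∩ W|² never drops, and strictly grows for W = N(u) ∪ N(v). So in an optimal graph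
-- vertices with a common neighbour have nested neighbourhoods; by connectedness "equal or with a
-- common neighbour" is then the same as "in the same class", and counting yields the weights.

{-# OPTIONS --safe #-}
module Submission where

open import Defs hiding (sym; irrefl)
open import Data.Nat using (ℕ; zero; suc; _≤_)
import Data.Nat as ℕ
import Data.Nat.Properties as ℕ
open import Data.Product using (∃; _×_; _,_; proj₁; proj₂)
open import Data.Fin as Fin using (Fin; zero; suc; toℕ; punchIn; punchOut)
import Data.Fin.Properties as Fin
open import Data.Fin.Patterns using (0F; 1F; 2F; 3F)
open import Data.Bool as Bool using (Bool; true; false; _∧_; _∨_; not; if_then_else_; T)
import Data.Bool.Properties as Bool
open import Data.List using ([]; _∷_)
open import Data.Vec as Vec using (Vec; []; _∷_; lookup; removeAt; _[_]≔_)
open import Data.Integer as ℤ using (ℤ; _+_; _*_; -_; _-_; 0ℤ; 1ℤ)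
open import Data.Vec.Properties using (lookup∘updateAt; lookup∘updateAt′; lookup-allFin; lookup-map)
import Data.Integer.Properties as ℤ
import Data.Rational as ℚ
import Data.Rational.Properties as ℚ
open import Data.Rational.Literals using (fromℤ)
open import Data.Integer.Tactic.RingSolver using (solve-∀)
open import Data.Sum using (_⊎_; inj₁; inj₂)
open import Data.Empty using (⊥; ⊥-elim)
open import Data.Unit using (⊤; tt)
open import Function using (_∘_; id)
open import Relation.Nullary using (¬_; Dec; yes; no; does)
open import Relation.Nullary.Decidable using (decidable-stable; dec-true; dec-false; T?; _→-dec_)
open import Relation.Binary.Definitions using (tri<; tri≈; tri>)
open import Relation.Binary.PropositionalEquality
  using (_≡_; _≢_; refl; sym; trans; cong; cong₂; subst; subst₂; module ≡-Reasoning)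
open import Algebra.Properties.Semiring.Sum ℤ.+-*-semiring
  using (sum; sum-cong-≗; sum-remove; ∑-distrib-+; ∑-comm; *-distribˡ-sum; *-distribʳ-sum)

-- The constants come from the 4 by 4 minors. A symmetric matrix with zero diagonal on four vertices
-- has determinant p² + q² + r² - 2pq - 2pr - 2qr, where p, q, r are the products over the three
-- perfect matchings. Summed over all ordered 4-tuples, each of the three squares gives (tr A²)²,
-- and each of the six cross products gives tr A⁴, since two different matchings together form a
-- closed 4-walk. The factor 24 counts the orderings of a 4-set; tuples with a repetition contribute
-- 0, so they can be included, and the sums can then be reindexed freely. The common neighbour is
-- what makes the exchange legitimate: if N(u) ∩ N(v) were empty, the exchange would isolate u and
-- leave the class of connected graphs. Nestedness is therefore first obtained only for vertices
-- with a common neighbour, and has to be carried along walks before it covers a whole class.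

sum-zero : ∀ {n} {f : Fin n → ℤ} → (∀ i → f i ≡ 0ℤ) → sum f ≡ 0ℤ
sum-zero {zero}  h = refl
sum-zero {suc n} h = cong₂ _+_ (h zero) (sum-zero (h ∘ suc))

sum-single : ∀ {n} (i : Fin n) (f : Fin n → ℤ) → (∀ j → j ≢ i → f j ≡ 0ℤ) → sum f ≡ f i
sum-single {suc n} i f h = trans (sum-remove {i = i} f)
  (trans (cong (f i +_) (sum-zero (λ j → h _ (Fin.punchInᵢ≢i i j)))) (ℤ.+-identityʳ (f i)))

-- Coefficient sequences of determinants of linear matrix pencils

Seq : Set
Seq = ℕ → ℤ

shift : Seq → Seq
shift s zero    = 0ℤ
shift s (suc k) = s k

shift-cong : ∀ {s t : Seq} → (∀ k → s k ≡ t k) → ∀ k → shift s k ≡ shift t k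
shift-cong h zero    = refl
shift-cong h (suc k) = h k

shift-scale : ∀ c (s : Seq) k → shift (λ k → c * s k) k ≡ c * shift s k
shift-scale c s zero    = sym (ℤ.*-zeroʳ c)
shift-scale c s (suc k) = refl

shift-lin : ∀ c (s t : Seq) k → shift (λ k → s k + c * t k) k ≡ shift s k + c * shift t k
shift-lin c s t zero    = sym (cong (λ z → 0ℤ + z) (ℤ.*-zeroʳ c))
shift-lin c s t (suc k) = refl

Matrix : ℕ → Set
Matrix n = Fin n → Fin n → ℤ

minor : ∀ {n} → Fin (suc n) → Fin (suc n) → Matrix (suc n) → Matrix n
minor r c M i j = M (punchIn r i) (punchIn c j)

-- The coefficient sequence of det (b + λ d).
pencil : ∀ n → Matrix n → Matrix n → Seq
pencil zero    b d zero    = 1ℤ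
pencil zero    b d (suc k) = 0ℤ
pencil (suc n) b d k = sum λ j → signℤ (toℕ j) *
  (b zero j * pencil n (minor zero j b) (minor zero j d) k +
   d zero j * shift (pencil n (minor zero j b) (minor zero j d)) k)

coeff-+ₚ : ∀ k p q → coeff k (p +ₚ q) ≡ coeff k p + coeff k q
coeff-+ₚ k       []      q       = sym (ℤ.+-identityˡ _)
coeff-+ₚ k       (a ∷ p) []      = sym (ℤ.+-identityʳ _)
coeff-+ₚ zero    (a ∷ p) (b ∷ q) = refl
coeff-+ₚ (suc k) (a ∷ p) (b ∷ q) = coeff-+ₚ k p q

coeff-scaleₚ : ∀ k a p → coeff k (scaleₚ a p) ≡ a * coeff k p
coeff-scaleₚ k       a []      = sym (ℤ.*-zeroʳ a)
coeff-scaleₚ zero    a (x ∷ p) = refl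
coeff-scaleₚ (suc k) a (x ∷ p) = coeff-scaleₚ k a p

coeff-sumPoly : ∀ k n f → coeff k (sumPoly n f) ≡ sum (λ i → coeff k (f i))
coeff-sumPoly k zero    f = refl
coeff-sumPoly k (suc n) f =
  trans (coeff-+ₚ k (f zero) _) (cong (λ z → coeff k (f zero) + z) (coeff-sumPoly k n (f ∘ suc)))

coeff-shift : ∀ k p → coeff k (0ℤ ∷ p) ≡ shift (λ i → coeff i p) k
coeff-shift zero    p = refl
coeff-shift (suc k) p = refl

coeff-∷-*ₚ : ∀ k a p q →
  coeff k ((a ∷ p) *ₚ q) ≡ a * coeff k q + shift (λ i → coeff i (p *ₚ q)) k
coeff-∷-*ₚ k a p q =
  trans (coeff-+ₚ k (scaleₚ a q) _) (cong₂ _+_ (coeff-scaleₚ k a q) (coeff-shift k (p *ₚ q)))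

-- `p` acts as b + d λ in products. Stated through coefficients of products because the entries of
-- the characteristic matrix are lists of different lengths: two coefficients on the diagonal, one
-- off it.
LinearEntry : Poly → ℤ → ℤ → Set
LinearEntry p b d =
  ∀ q k → coeff k (p *ₚ q) ≡ b * coeff k q + d * shift (λ i → coeff i q) k

constant-entry : ∀ a → LinearEntry (a ∷ []) a 0ℤ
constant-entry a q k = trans (coeff-∷-*ₚ k a [] q)
  (cong (λ z → a * coeff k q + z) (trans (shift-zero k) (sym (ℤ.*-zeroˡ (shift (λ i → coeff i q) k)))))
  where
  shift-zero : ∀ k → shift (λ i → coeff i []) k ≡ 0ℤ
  shift-zero zero    = refl
  shift-zero (suc k) = refl

linear-entry : ∀ a d → LinearEntry (a ∷ d ∷ []) a d
linear-entry a d q k = trans (coeff-∷-*ₚ k a (d ∷ []) q) (cong (λ z → a * coeff k q + z)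
  (trans (shift-cong inner k) (shift-scale d (λ i → coeff i q) k)))
  where
  inner : ∀ i → coeff i ((d ∷ []) *ₚ q) ≡ d * coeff i q
  inner i = trans (constant-entry d q i)
    (trans (cong (λ z → d * coeff i q + z) (ℤ.*-zeroˡ (shift (λ i → coeff i q) i))) (ℤ.+-identityʳ _))

coeff-det : ∀ n M b d → (∀ i j → LinearEntry (M i j) (b i j) (d i j)) →
  ∀ k → coeff k (det n M) ≡ pencil n b d k
coeff-det zero    M b d h zero    = refl
coeff-det zero    M b d h (suc k) = refl
coeff-det (suc n) M b d h k =
  trans (coeff-sumPoly k (suc n) (λ j → scaleₚ (signℤ (toℕ j)) (M zero j *ₚ D j))) (sum-cong-≗ λ j →
  trans (coeff-scaleₚ k (signℤ (toℕ j)) (M zero j *ₚ D j)) (cong (signℤ (toℕ j) *_)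
  (trans (h zero j (D j) k) (cong₂ (λ x y → b zero j * x + d zero j * y)
    (ih j k) (shift-cong (ih j) k)))))
  where
  D : Fin (suc n) → Poly
  D j = det n (λ r c → M (suc r) (punchIn j c))
  ih : ∀ j k → coeff k (D j) ≡ pencil n (minor zero j b) (minor zero j d) k
  ih j = coeff-det n _ (minor zero j b) (minor zero j d) (λ r c → h (suc r) (punchIn j c))

pencil-cong : ∀ n {b b' d d' : Matrix n} → (∀ i j → b i j ≡ b' i j) → (∀ i j → d i j ≡ d' i j) →
  ∀ k → pencil n b d k ≡ pencil n b' d' k
pencil-cong zero    hb hd zero    = refl
pencil-cong zero    hb hd (suc k) = refl
pencil-cong (suc n) {b} {b'} {d} {d'} hb hd k = sum-cong-≗ λ j → cong (signℤ (toℕ j) *_)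
  (cong₂ _+_ (cong₂ _*_ (hb zero j) (ih j k)) (cong₂ _*_ (hd zero j) (shift-cong (ih j) k)))
  where
  ih : ∀ j k → pencil n (minor zero j b) (minor zero j d) k ≡ pencil n (minor zero j b') (minor zero j d') k
  ih j = pencil-cong n (λ r c → hb (suc r) (punchIn j c)) (λ r c → hd (suc r) (punchIn j c))

-- Column deletion, signs, and changing one entry of a pencil

δ : ∀ {n} → Fin n → Fin n → ℤ
δ i j = if does (i Fin.≟ j) then 1ℤ else 0ℤ

δ-refl : ∀ {n} (i : Fin n) → δ i i ≡ 1ℤ
δ-refl i with i Fin.≟ i
... | yes _ = refl
... | no ≢  = ⊥-elim (≢ refl)

δ-≢ : ∀ {n} {i j : Fin n} → i ≢ j → δ i j ≡ 0ℤ
δ-≢ {i = i} {j} ≢ with i Fin.≟ j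
... | yes eq = ⊥-elim (≢ eq)
... | no _   = refl

δ-punchIn : ∀ {n} (j : Fin (suc n)) (x y : Fin n) → δ (punchIn j x) (punchIn j y) ≡ δ x y
δ-punchIn j x y with x Fin.≟ y
... | yes refl = δ-refl (punchIn j x)
... | no x≢y   = δ-≢ (x≢y ∘ Fin.punchIn-injective j x y)

-- Removing column c and then column j of the rest amounts to removing column
-- punchIn c j and then column punchDown c j of the rest.
punchDown : ∀ {n} → Fin (suc (suc n)) → Fin (suc n) → Fin (suc n)
punchDown         zero    j       = zero
punchDown         (suc c) zero    = c
punchDown {suc n} (suc c) (suc j) = suc (punchDown c j)

punchIn-punchDown : ∀ {n} (c : Fin (suc (suc n))) j → punchIn (punchIn c j) (punchDown c j) ≡ c
punchIn-punchDown         zero    j       = refl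
punchIn-punchDown         (suc c) zero    = refl
punchIn-punchDown {suc n} (suc c) (suc j) = cong suc (punchIn-punchDown c j)

punchIn-comm : ∀ {n} (c : Fin (suc (suc n))) j (x : Fin n) →
  punchIn (punchIn c j) (punchIn (punchDown c j) x) ≡ punchIn c (punchIn j x)
punchIn-comm         zero    j       x       = refl
punchIn-comm         (suc c) zero    x       = refl
punchIn-comm {suc n} (suc c) (suc j) zero    = refl
punchIn-comm {suc n} (suc c) (suc j) (suc x) = cong suc (punchIn-comm c j x)

sign-suc : ∀ k → signℤ (suc k) ≡ - signℤ k
sign-suc zero          = refl
sign-suc (suc zero)    = refl
sign-suc (suc (suc k)) = sign-suc k

sign-sq : ∀ k → signℤ k * signℤ k ≡ 1ℤ
sign-sq zero          = refl
sign-sq (suc zero)    = refl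
sign-sq (suc (suc k)) = sign-sq k

sgn : ∀ {n} → Fin n → ℤ
sgn i = signℤ (toℕ i)

sgn-suc : ∀ {n} (i : Fin n) → sgn (suc i) ≡ - sgn i
sgn-suc i = sign-suc (toℕ i)

neg-neg-* : ∀ x y → (- x) * (- y) ≡ x * y
neg-neg-* = solve-∀

neg-*-one : ∀ x → (- x) * 1ℤ ≡ - (1ℤ * x)
neg-*-one = solve-∀

one-*-neg : ∀ x → 1ℤ * x ≡ - ((- x) * 1ℤ)
one-*-neg = solve-∀

-- The two orders of deleting the same pair of columns differ by a transposition, hence the opposite
-- sign.
sgn-punch : ∀ {n} (c : Fin (suc (suc n))) j →
  sgn (punchIn c j) * sgn (punchDown c j) ≡ - (sgn c * sgn j)
sgn-punch zero j = trans (cong (_* 1ℤ) (sgn-suc j)) (neg-*-one (sgn j))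
sgn-punch (suc c) zero = trans (one-*-neg (sgn c)) (cong (λ z → - (z * 1ℤ)) (sym (sgn-suc c)))
sgn-punch {suc n} (suc c) (suc j) = trans
  (trans (cong₂ _*_ (sgn-suc (punchIn c j)) (sgn-suc (punchDown c j))) (neg-neg-* (sgn (punchIn c j)) (sgn (punchDown c j))))
  (trans (sgn-punch c j)
    (cong -_ (sym (trans (cong₂ _*_ (sgn-suc c) (sgn-suc j)) (neg-neg-* (sgn c) (sgn j))))))

-- Linearity of the determinant in row r combined with Laplace expansion of a
-- unit row: adding λ e_c to row r.
pencil-bump : ∀ n (r c : Fin (suc n)) (b d d' : Matrix (suc n)) →
  (∀ j → d r j ≡ d' r j + δ c j) →
  (∀ i j → i ≢ r → d i j ≡ d' i j) →
  ∀ k → pencil (suc n) b d k ≡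
    pencil (suc n) b d' k + sgn r * sgn c * shift (pencil n (minor r c b) (minor r c d')) k
pencil-bump n zero c b d d' hr ho k = begin
  pencil (suc n) b d k
    ≡⟨ sum-cong-≗ (λ j → trans (cong (sgn j *_) (cong₂ _+_ (cong (b zero j *_) (same j k))
          (cong₂ _*_ (hr j) (shift-cong (same j) k)))) (expand (sgn j) (b zero j) (P j k) (d' zero j) (δ c j) (shift (P j) k))) ⟩
  sum (λ j → sgn j * (b zero j * P j k + d' zero j * shift (P j) k) + sgn j * (δ c j * shift (P j) k))
    ≡⟨ ∑-distrib-+ (λ j → sgn j * (b zero j * P j k + d' zero j * shift (P j) k)) (λ j → sgn j * (δ c j * shift (P j) k)) ⟩
  pencil (suc n) b d' k + sum (λ j → sgn j * (δ c j * shift (P j) k))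
    ≡⟨ cong (pencil (suc n) b d' k +_) (sum-single c (λ j → sgn j * (δ c j * shift (P j) k)) λ j j≢c →
         trans (cong (λ z → sgn j * (z * shift (P j) k)) (δ-≢ (j≢c ∘ sym))) (ℤ.*-zeroʳ (sgn j))) ⟩
  pencil (suc n) b d' k + sgn c * (δ c c * shift (P c) k)
    ≡⟨ cong (pencil (suc n) b d' k +_)
         (trans (cong (λ z → sgn c * (z * shift (P c) k)) (δ-refl c)) (tidy (sgn c) (shift (P c) k))) ⟩
  pencil (suc n) b d' k + 1ℤ * sgn c * shift (P c) k ∎
  where
  open ≡-Reasoning
  P : Fin (suc n) → Seq
  P j = pencil n (minor zero j b) (minor zero j d')
  same : ∀ j k → pencil n (minor zero j b) (minor zero j d) k ≡ P j k
  same j = pencil-cong n {b = minor zero j b} (λ _ _ → refl) (λ i y → ho (suc i) (punchIn j y) λ ())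
  expand : ∀ s b p d e q → s * (b * p + (d + e) * q) ≡ s * (b * p + d * q) + s * (e * q)
  expand = solve-∀
  tidy : ∀ s q → s * (1ℤ * q) ≡ 1ℤ * s * q
  tidy = solve-∀
pencil-bump (suc n) (suc r) c b d d' hr ho k = begin
  sum (F d)
    ≡⟨ sum-remove {i = c} (F d) ⟩
  F d c + sum (λ j → F d (punchIn c j))
    ≡⟨ cong₂ _+_ at-c (trans (sum-cong-≗ off-c) (∑-distrib-+ (λ j → F d' (punchIn c j)) (λ j → σ * G j))) ⟩
  F d' c + (sum (λ j → F d' (punchIn c j)) + sum (λ j → σ * G j))
    ≡⟨ sym (ℤ.+-assoc (F d' c) _ _) ⟩
  F d' c + sum (λ j → F d' (punchIn c j)) + sum (λ j → σ * G j)
    ≡⟨ cong₂ _+_ (sym (sum-remove {i = c} (F d'))) (sym (*-distribˡ-sum σ G)) ⟩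
  pencil (suc (suc n)) b d' k + σ * sum G
    ≡⟨ cong (λ z → pencil (suc (suc n)) b d' k + σ * z) (sum-G k) ⟩
  pencil (suc (suc n)) b d' k + σ * shift (pencil (suc n) (minor (suc r) c b) (minor (suc r) c d')) k ∎
  where
  open ≡-Reasoning
  P : Matrix (suc (suc n)) → Fin (suc (suc n)) → Seq
  P e j = pencil (suc n) (minor zero j b) (minor zero j e)
  F : Matrix (suc (suc n)) → Fin (suc (suc n)) → ℤ
  F e j = sgn j * (b zero j * P e j k + e zero j * shift (P e j) k)
  σ : ℤ
  σ = sgn (suc r) * sgn c
  R : Fin (suc n) → Seq
  R j = pencil n (minor zero j (minor (suc r) c b)) (minor zero j (minor (suc r) c d'))
  term : Fin (suc n) → Seq
  term j k = sgn j * (b zero (punchIn c j) * R j k + d' zero (punchIn c j) * shift (R j) k)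
  G : Fin (suc n) → ℤ
  G j = shift (term j) k
  sum-G : ∀ k → sum (λ j → shift (term j) k) ≡
    shift (pencil (suc n) (minor (suc r) c b) (minor (suc r) c d')) k
  sum-G zero    = sum-zero {suc n} (λ _ → refl)
  sum-G (suc k) = refl
  -- The cofactor at column `c` has lost that column, and with it the only entry in which `d` and
  -- `d'` differ.
  at-c : F d c ≡ F d' c
  at-c = cong (sgn c *_) (cong₂ _+_ (cong (b zero c *_) (same k))
    (cong₂ _*_ (ho zero c λ ()) (shift-cong same k)))
    where
    same : ∀ k → P d c k ≡ P d' c k
    same = pencil-cong (suc n) {b = minor zero c b} (λ _ _ → refl) entry
      where
      entry : ∀ i y → d (suc i) (punchIn c y) ≡ d' (suc i) (punchIn c y)
      entry i y with i Fin.≟ r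
      ... | yes refl = trans (hr (punchIn c y))
              (trans (cong (d' (suc i) (punchIn c y) +_) (δ-≢ (Fin.punchInᵢ≢i c y ∘ sym))) (ℤ.+-identityʳ _))
      ... | no i≢r = ho (suc i) (punchIn c y) (i≢r ∘ Fin.suc-injective)
  -- Here the minor still contains the changed entry, now in column `punchDown c j`, so the
  -- induction hypothesis applies; `sgn-punch` reconciles deleting `punchIn c j` first with deleting
  -- `c` first.
  off-c : ∀ j → F d (punchIn c j) ≡ F d' (punchIn c j) + σ * G j
  off-c j = begin
    F d c'
      ≡⟨ cong (sgn c' *_) (cong₂ _+_ (cong (b zero c' *_) (ih k))
           (cong₂ _*_ (ho zero c' λ ()) (trans (shift-cong ih k) (shift-lin τ (P d' c') (shift (R j)) k)))) ⟩
    sgn c' * (b zero c' * (P d' c' k + τ * shift (R j) k) +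
              d' zero c' * (shift (P d' c') k + τ * shift (shift (R j)) k))
      ≡⟨ gather (sgn c') (sgn r) (sgn (punchDown c j)) (b zero c') (d' zero c')
           (P d' c' k) (shift (P d' c') k) (shift (R j) k) (shift (shift (R j)) k) ⟩
    F d' c' + sgn c' * sgn (punchDown c j) * (sgn r * H)
      ≡⟨ cong (λ z → F d' c' + z * (sgn r * H)) (sgn-punch c j) ⟩
    F d' c' + - (sgn c * sgn j) * (sgn r * H)
      ≡⟨ cong (F d' c' +_) (regroup (sgn c) (sgn j) (sgn r) H) ⟩
    F d' c' + (- sgn r) * sgn c * (sgn j * H)
      ≡⟨ cong₂ (λ x y → F d' c' + x * sgn c * y) (sym (sgn-suc r)) (sym (shift-term k)) ⟩
    F d' c' + σ * G j ∎
    where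
    c' = punchIn c j
    τ = sgn r * sgn (punchDown c j)
    H = b zero c' * shift (R j) k + d' zero c' * shift (shift (R j)) k
    gather : ∀ s r e b d p q u v →
      s * (b * (p + r * e * u) + d * (q + r * e * v)) ≡
      s * (b * p + d * q) + s * e * (r * (b * u + d * v))
    gather = solve-∀
    regroup : ∀ c j r h → - (c * j) * (r * h) ≡ (- r) * c * (j * h)
    regroup = solve-∀
    shift-term : ∀ k → shift (term j) k ≡
      sgn j * (b zero c' * shift (R j) k + d' zero c' * shift (shift (R j)) k)
    shift-term zero    = vanish (sgn j) (b zero c') (d' zero c')
      where
      vanish : ∀ s x y → 0ℤ ≡ s * (x * 0ℤ + y * 0ℤ)
      vanish = solve-∀
    shift-term (suc k) = refl
    minors : ∀ (M : Matrix (suc (suc n))) x y →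
      minor r (punchDown c j) (minor zero c' M) x y ≡ minor zero j (minor (suc r) c M) x y
    minors M x y = cong (M (suc (punchIn r x))) (punchIn-comm c j y)
    ih : ∀ k → P d c' k ≡ P d' c' k + τ * shift (R j) k
    ih k = trans
      (pencil-bump n r (punchDown c j) (minor zero c' b) (minor zero c' d) (minor zero c' d')
        (λ y → trans (hr (punchIn c' y)) (cong (d' (suc r) (punchIn c' y) +_)
          (trans (cong (λ z → δ z (punchIn c' y)) (sym (punchIn-punchDown c j))) (δ-punchIn c' _ y))))
        (λ i y i≢r → ho (suc i) (punchIn c' y) (i≢r ∘ Fin.suc-injective)) k)
      (cong (λ z → P d' c' k + τ * z) (shift-cong (pencil-cong n (minors b) (minors d')) k))

-- From sums over subsets to sums over tuples

subseqSum : ∀ {X : Set} j → (Vec X j → ℤ) → ∀ {n} → Vec X n → ℤ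
subseqSum zero    g s       = g []
subseqSum (suc j) g []      = 0ℤ
subseqSum (suc j) g (x ∷ s) = subseqSum j (g ∘ (x ∷_)) s + subseqSum (suc j) g s

subseqSum-cong : ∀ {X : Set} j {g h : Vec X j → ℤ} → (∀ v → g v ≡ h v) →
  ∀ {n} (s : Vec X n) → subseqSum j g s ≡ subseqSum j h s
subseqSum-cong zero    eq s       = eq []
subseqSum-cong (suc j) eq []      = refl
subseqSum-cong (suc j) eq (x ∷ s) =
  cong₂ _+_ (subseqSum-cong j (λ v → eq (x ∷ v)) s) (subseqSum-cong (suc j) eq s)

subseqSum-zero : ∀ {X : Set} j {g : Vec X j → ℤ} → (∀ v → g v ≡ 0ℤ) →
  ∀ {n} (s : Vec X n) → subseqSum j g s ≡ 0ℤ
subseqSum-zero zero    eq s       = eq []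
subseqSum-zero (suc j) eq []      = refl
subseqSum-zero (suc j) eq (x ∷ s) =
  cong₂ _+_ (subseqSum-zero j (λ v → eq (x ∷ v)) s) (subseqSum-zero (suc j) eq s)

subseqSum-short : ∀ {X : Set} j (g : Vec X j → ℤ) {n} (s : Vec X n) → n ℕ.< j → subseqSum j g s ≡ 0ℤ
subseqSum-short (suc j) g []      _           = refl
subseqSum-short (suc j) g (x ∷ s) (ℕ.s≤s n<j) =
  cong₂ _+_ (subseqSum-short j _ s n<j) (subseqSum-short (suc j) g s (ℕ.m<n⇒m<1+n n<j))

tupleSum : ∀ {X : Set} j → (Vec X j → ℤ) → ∀ {n} → Vec X n → ℤ
tupleSum zero    g s = g []
tupleSum (suc j) g s = sum λ i → tupleSum j (g ∘ (lookup s i ∷_)) s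

-- Only neighbouring arguments are compared, at every depth. Adjacent transpositions generate all
-- permutations and bring equal arguments together, so `g` is fully symmetric and vanishes on every
-- tuple with a repetition.
SymmetricOffDiagonal : ∀ {X : Set} j → (Vec X j → ℤ) → Set
SymmetricOffDiagonal zero          g = ⊤
SymmetricOffDiagonal (suc zero)    g = ⊤
SymmetricOffDiagonal (suc (suc j)) g =
  (∀ x y v → g (x ∷ y ∷ v) ≡ g (y ∷ x ∷ v)) ×
  (∀ x v → g (x ∷ x ∷ v) ≡ 0ℤ) ×
  (∀ x → SymmetricOffDiagonal (suc j) (g ∘ (x ∷_)))

SymmetricOffDiagonal-tail : ∀ {X : Set} j {g : Vec X (suc j) → ℤ} → SymmetricOffDiagonal (suc j) g →
  ∀ x → SymmetricOffDiagonal j (g ∘ (x ∷_))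
SymmetricOffDiagonal-tail zero    _           x = tt
SymmetricOffDiagonal-tail (suc j) (_ , _ , h) x = h x

fromℕ : ℕ → ℤ
fromℕ = ℤ.+_

-- Double counting: a (j+1)-subset arises once for each of its elements moved to the front. On the
-- right the other elements are drawn from all of `s`, but choices that repeat the front position
-- contribute 0.
subseqSum-first : ∀ {X : Set} j (g : Vec X (suc j) → ℤ) → SymmetricOffDiagonal (suc j) g → ∀ {n} (s : Vec X n) →
  fromℕ (suc j) * subseqSum (suc j) g s ≡ sum (λ i → subseqSum j (g ∘ (lookup s i ∷_)) s)
subseqSum-first zero g _ [] = refl
subseqSum-first zero g _ (x ∷ s) = begin
  1ℤ * (g (x ∷ []) + subseqSum 1 g s)          ≡⟨ ℤ.*-distribˡ-+ 1ℤ (g (x ∷ [])) _ ⟩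
  1ℤ * g (x ∷ []) + 1ℤ * subseqSum 1 g s       ≡⟨ cong₂ _+_ (ℤ.*-identityˡ (g (x ∷ []))) (subseqSum-first zero g tt s) ⟩
  g (x ∷ []) + sum (λ i → g (lookup s i ∷ [])) ∎
  where open ≡-Reasoning
subseqSum-first (suc j) g (_ , _ , _) [] = ℤ.*-zeroʳ (fromℕ (suc (suc j)))
subseqSum-first (suc j) g sym-g@(swap , diag , tail) (y ∷ s) = begin
  fromℕ (suc (suc j)) * (U + V)
    ≡⟨ cong (_* (U + V)) (ℤ.pos-+ 1 (suc j)) ⟩
  (1ℤ + fromℕ (suc j)) * (U + V)
    ≡⟨ spread (fromℕ (suc j)) U V ⟩
  U + (fromℕ (suc j) * U + (1ℤ + fromℕ (suc j)) * V)
    ≡⟨ cong (U +_) (cong₂ _+_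
        (trans (subseqSum-first j (g ∘ (y ∷_)) (tail y) s)
          (sum-cong-≗ λ i → subseqSum-cong j (λ v → swap y (lookup s i) v) s))
        (trans (cong (_* V) (sym (ℤ.pos-+ 1 (suc j)))) (subseqSum-first (suc j) g sym-g s))) ⟩
  U + (sum (λ i → subseqSum j (g ∘ (lookup s i ∷_) ∘ (y ∷_)) s) +
       sum (λ i → subseqSum (suc j) (g ∘ (lookup s i ∷_)) s))
    ≡⟨ cong (U +_) (sym (∑-distrib-+ (λ i → subseqSum j (g ∘ (lookup s i ∷_) ∘ (y ∷_)) s) _)) ⟩
  U + sum (λ i → subseqSum (suc j) (g ∘ (lookup s i ∷_)) (y ∷ s))
    -- With `y` in front, the subsequences of `y ∷ s` that take `y` again vanish, which leaves `U`.
    ≡⟨ cong (λ z → z + sum (λ i → subseqSum (suc j) (g ∘ (lookup s i ∷_)) (y ∷ s)))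
         (sym (trans (cong (_+ U) (subseqSum-zero j (diag y) s)) (ℤ.+-identityˡ U))) ⟩
  subseqSum (suc j) (g ∘ (y ∷_)) (y ∷ s) + sum (λ i → subseqSum (suc j) (g ∘ (lookup s i ∷_)) (y ∷ s)) ∎
  where
  open ≡-Reasoning
  U = subseqSum (suc j) (g ∘ (y ∷_)) s
  V = subseqSum (suc (suc j)) g s
  spread : ∀ f u v → (1ℤ + f) * (u + v) ≡ u + (f * u + (1ℤ + f) * v)
  spread = solve-∀

factorial : ℕ → ℤ
factorial zero    = 1ℤ
factorial (suc j) = factorial j * fromℕ (suc j)

factorial*subseqSum : ∀ {X : Set} j (g : Vec X j → ℤ) → SymmetricOffDiagonal j g → ∀ {n} (s : Vec X n) →
  factorial j * subseqSum j g s ≡ tupleSum j g s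
factorial*subseqSum zero    g _  s = ℤ.*-identityˡ (g [])
factorial*subseqSum (suc j) g sg s = begin
  factorial j * fromℕ (suc j) * subseqSum (suc j) g s
    ≡⟨ ℤ.*-assoc (factorial j) (fromℕ (suc j)) _ ⟩
  factorial j * (fromℕ (suc j) * subseqSum (suc j) g s)
    ≡⟨ cong (factorial j *_) (subseqSum-first j g sg s) ⟩
  factorial j * sum (λ i → subseqSum j (g ∘ (lookup s i ∷_)) s)
    ≡⟨ *-distribˡ-sum (factorial j) (λ i → subseqSum j (g ∘ (lookup s i ∷_)) s) ⟩
  sum (λ i → factorial j * subseqSum j (g ∘ (lookup s i ∷_)) s)
    ≡⟨ sum-cong-≗ (λ i → factorial*subseqSum j _ (SymmetricOffDiagonal-tail j sg (lookup s i)) s) ⟩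
  tupleSum (suc j) g s ∎
  where open ≡-Reasoning

lookup-removeAt : ∀ {Y : Set} {n} (v : Vec Y (suc n)) i j → lookup (removeAt v i) j ≡ lookup v (punchIn i j)
lookup-removeAt (x ∷ v)           zero    j       = refl
lookup-removeAt (x ∷ v@(_ ∷ _)) (suc i) zero    = refl
lookup-removeAt (x ∷ v@(_ ∷ _)) (suc i) (suc j) = lookup-removeAt v i j

-- Expanding det (A + λ I) into principal minors

module Tagged {X : Set} (A : X → X → ℤ) where

  entries : ∀ {n} → Vec (X × Bool) n → Matrix n
  entries v i j = A (proj₁ (lookup v i)) (proj₁ (lookup v j))

  tags : ∀ {n} → Vec (X × Bool) n → Matrix n
  tags v i j = if proj₂ (lookup v i) then δ i j else 0ℤ

  -- Coefficients of det (A[v] + λ D), with D the diagonal indicator of the tagged positions.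
  opaque
    tagged : ∀ {n} → Vec (X × Bool) n → Seq
    tagged {n} v = pencil n (entries v) (tags v)

    tagged-pencil : ∀ {n} (v : Vec (X × Bool) n) k → tagged v k ≡ pencil n (entries v) (tags v) k
    tagged-pencil v k = refl

  -- Row `i` is a row of A plus λ times a unit vector, so linearity splits off λ times the
  -- determinant with row and column `i` deleted. The two cofactor signs are equal and cancel.
  tagged-untag : ∀ {n} (v : Vec (X × Bool) (suc n)) i x → lookup v i ≡ (x , true) →
    ∀ k → tagged v k ≡ tagged (v [ i ]≔ (x , false)) k + shift (tagged (removeAt v i)) k
  tagged-untag {n} v i x vi k = begin
    tagged v k
      ≡⟨ tagged-pencil v k ⟩
    pencil (suc n) (entries v) (tags v) k
      ≡⟨ pencil-bump n i i (entries v) (tags v) (tags v') at-i off-i k ⟩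
    pencil (suc n) (entries v) (tags v') k + sgn i * sgn i * shift (pencil n (minor i i (entries v)) (minor i i (tags v'))) k
      ≡⟨ cong₂ _+_ (pencil-cong (suc n) {entries v} {entries v'} {tags v'} {tags v'} (λ r c → cong₂ A (same-label r) (same-label c)) (λ _ _ → refl) k)
           (trans (cong (_* shift (pencil n (minor i i (entries v)) (minor i i (tags v'))) k) (sign-sq (toℕ i))) (trans (ℤ.*-identityˡ (shift (pencil n (minor i i (entries v)) (minor i i (tags v'))) k))
             (shift-cong (pencil-cong n {minor i i (entries v)} {entries (removeAt v i)} {minor i i (tags v')}
               (λ r c → cong₂ (λ a b → A (proj₁ a) (proj₁ b))
                 (sym (lookup-removeAt v i r)) (sym (lookup-removeAt v i c))) minor-tags) k))) ⟩
    pencil (suc n) (entries v') (tags v') k + shift (pencil n (entries (removeAt v i)) (tags (removeAt v i))) k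
      ≡⟨ sym (cong₂ _+_ (tagged-pencil v' k) (shift-cong (tagged-pencil (removeAt v i)) k)) ⟩
    tagged v' k + shift (tagged (removeAt v i)) k ∎
    where
    open ≡-Reasoning
    v' = v [ i ]≔ (x , false)
    off : ∀ r → r ≢ i → lookup v' r ≡ lookup v r
    off r r≢i = lookup∘updateAt′ r i r≢i v
    same-label : ∀ r → proj₁ (lookup v r) ≡ proj₁ (lookup v' r)
    same-label r with r Fin.≟ i
    ... | yes refl = trans (cong proj₁ vi) (cong proj₁ (sym (lookup∘updateAt r v)))
    ... | no r≢i   = cong proj₁ (sym (off r r≢i))
    at-i : ∀ j → tags v i j ≡ tags v' i j + δ i j
    at-i j rewrite lookup∘updateAt i {f = λ _ → (x , false)} v | vi = sym (ℤ.+-identityˡ (δ i j))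
    off-i : ∀ r j → r ≢ i → tags v r j ≡ tags v' r j
    off-i r j r≢i = cong (λ t → if proj₂ t then δ r j else 0ℤ) (sym (off r r≢i))
    minor-tags : ∀ r c → minor i i (tags v') r c ≡ tags (removeAt v i) r c
    minor-tags r c = cong₂ (λ t z → if proj₂ t then z else 0ℤ)
      (trans (off (punchIn i r) (Fin.punchInᵢ≢i i r)) (sym (lookup-removeAt v i r)))
      (δ-punchIn i r c)

  free : ∀ {n} → Vec X n → Vec (X × Bool) n
  free = Vec.map (_, true)

  fixed : ∀ {n} → Vec X n → Vec (X × Bool) n
  fixed = Vec.map (_, false)

  #tags : ∀ {n} → Vec (X × Bool) n → ℕ
  #tags []              = 0
  #tags ((_ , true) ∷ v)  = suc (#tags v)
  #tags ((_ , false) ∷ v) = #tags v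

  #tags-free : ∀ {n} (s : Vec X n) → #tags (free s) ≡ n
  #tags-free []      = refl
  #tags-free (x ∷ s) = cong suc (#tags-free s)

  -- Only tagged rows contain λ, and each term of the expansion takes one entry per row. Stated for
  -- arbitrary `b` and `d`, because deleting a row and a column destroys the diagonal form of `tags`
  -- while the zero rows survive.
  pencil-degree : ∀ {n} (v : Vec (X × Bool) n) (b d : Matrix n) →
    (∀ i j → proj₂ (lookup v i) ≡ false → d i j ≡ 0ℤ) → ∀ k → #tags v ℕ.< k → pencil n b d k ≡ 0ℤ
  pencil-degree [] b d h (suc k) _ = refl
  pencil-degree {suc n} ((_ , false) ∷ v) b d h k lt = sum-zero λ j →
    trans (cong (sgn j *_) (cong₂ (λ p q → b zero j * p + q * shift (pencil n (minor zero j b) (minor zero j d)) k)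
      (pencil-degree v (minor zero j b) (minor zero j d) (λ i c → h (suc i) (punchIn j c)) k lt) (h zero j refl)))
    (vanish (sgn j) (b zero j) (shift (pencil n (minor zero j b) (minor zero j d)) k))
    where
    vanish : ∀ s b p → s * (b * 0ℤ + 0ℤ * p) ≡ 0ℤ
    vanish = solve-∀
  pencil-degree {suc n} ((_ , true) ∷ v) b d h (suc k) (ℕ.s≤s lt) = sum-zero λ j →
    trans (cong (sgn j *_) (cong₂ (λ p q → b zero j * p + d zero j * q)
      (pencil-degree v (minor zero j b) (minor zero j d) (λ i c → h (suc i) (punchIn j c)) (suc k) (ℕ.m<n⇒m<1+n lt))
      (pencil-degree v (minor zero j b) (minor zero j d) (λ i c → h (suc i) (punchIn j c)) k lt)))
    (vanish (sgn j) (b zero j) (d zero j))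
    where
    vanish : ∀ s b d → s * (b * 0ℤ + d * 0ℤ) ≡ 0ℤ
    vanish = solve-∀

  tagged-degree : ∀ {n} (v : Vec (X × Bool) n) k → #tags v ℕ.< k → tagged v k ≡ 0ℤ
  tagged-degree v k lt = trans (tagged-pencil v k) (pencil-degree v (entries v) (tags v)
    (λ i j untagged → cong (λ t → if t then δ i j else 0ℤ) untagged) k lt)

  principalMinor : ∀ {j} → Vec X j → ℤ
  principalMinor t = tagged (fixed t) 0

  -- L puts a fixed untagged prefix in front of its argument.
  Untaggable : ∀ {ℓ : ℕ → ℕ} → (∀ {n} → Vec (X × Bool) n → Vec (X × Bool) (ℓ n)) → Set
  Untaggable L = ∀ {n} x (s : Vec X n) k →
    tagged (L ((x , true) ∷ free s)) k ≡
    tagged (L ((x , false) ∷ free s)) k + shift (tagged (L (free s))) k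

  -- The head either joins the chosen subset and stays untagged, or supplies a factor λ and is
  -- deleted. The degree `k` counts the deletions, so `k + suc j ≡ n` leaves `suc j` elements to
  -- choose.
  tagged-step : ∀ {ℓ : ℕ → ℕ} (L : ∀ {n} → Vec (X × Bool) n → Vec (X × Bool) (ℓ n)) → Untaggable L →
    ∀ j (g : Vec X (suc j) → ℤ) →
    (∀ x {n} (s : Vec X n) k → k ℕ.+ j ≡ n → tagged (L ((x , false) ∷ free s)) k ≡ subseqSum j (g ∘ (x ∷_)) s) →
    ∀ {n} (s : Vec X n) k → k ℕ.+ suc j ≡ n → tagged (L (free s)) k ≡ subseqSum (suc j) g s
  tagged-step L untag j g h []      k       eq with () ← trans (sym (ℕ.+-suc k j)) eq
  -- No deletion is left: the shifted term is 0, and `s`, of length `j`, has no subsequence of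
  -- length `suc j`.
  tagged-step L untag j g h (x ∷ s) zero    eq = trans (untag x s zero)
    (cong₂ _+_ (h x s zero (ℕ.suc-injective eq))
      (sym (subseqSum-short (suc j) g s (ℕ.≤-reflexive (sym eq)))))
  tagged-step L untag j g h (x ∷ s) (suc k) eq = trans (untag x s (suc k))
    (cong₂ _+_ (h x s (suc k) (trans (sym (ℕ.+-suc k j)) (ℕ.suc-injective eq)))
      (tagged-step L untag j g h s k (ℕ.suc-injective eq)))

  -- Every remaining element must supply its λ: untagging one leaves fewer tags than the degree
  -- asked for.
  tagged-top : ∀ a b c d {n} (s : Vec X n) k → k ℕ.+ 0 ≡ n →
    tagged ((a , false) ∷ (b , false) ∷ (c , false) ∷ (d , false) ∷ free s) k ≡
    principalMinor (a ∷ b ∷ c ∷ d ∷ [])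
  tagged-top a b c d []      zero    eq = refl
  tagged-top a b c d (x ∷ s) (suc k) eq = trans
    (tagged-untag ((a , false) ∷ (b , false) ∷ (c , false) ∷ (d , false) ∷ (x , true) ∷ free s)
      (suc (suc (suc (suc zero)))) x refl (suc k))
    (trans (cong₂ _+_
      (tagged-degree ((a , false) ∷ (b , false) ∷ (c , false) ∷ (d , false) ∷ (x , false) ∷ free s) (suc k)
        (ℕ.≤-reflexive (cong suc (trans (#tags-free s) (sym (trans (sym (ℕ.+-identityʳ k)) (ℕ.suc-injective eq)))))))
      (tagged-top a b c d s k (ℕ.suc-injective eq)))
    (ℤ.+-identityˡ _))

  tagged-fourth : ∀ {n} (s : Vec X n) k → k ℕ.+ 4 ≡ n → tagged (free s) k ≡ subseqSum 4 principalMinor s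
  tagged-fourth =
    tagged-step id (λ x s → tagged-untag ((x , true) ∷ free s) zero x refl) 3 _ λ a →
    tagged-step (λ v → (a , false) ∷ v)
      (λ x s → tagged-untag ((a , false) ∷ (x , true) ∷ free s) (suc zero) x refl) 2 _ λ b →
    tagged-step (λ v → (a , false) ∷ (b , false) ∷ v)
      (λ x s → tagged-untag ((a , false) ∷ (b , false) ∷ (x , true) ∷ free s) (suc (suc zero)) x refl) 1 _ λ c →
    tagged-step (λ v → (a , false) ∷ (b , false) ∷ (c , false) ∷ v)
      (λ x s → tagged-untag ((a , false) ∷ (b , false) ∷ (c , false) ∷ (x , true) ∷ free s)
        (suc (suc (suc zero))) x refl) 0 _ λ d →
    tagged-top a b c d

-- The 4 by 4 determinant

-- The determinant of a symmetric 4×4 matrix with zero diagonal, in terms of the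
-- products of its entries over the three perfect matchings of the indices.
Δ : ℤ → ℤ → ℤ → ℤ
Δ p q r = p * p + q * q + r * r - (p * q + p * q) - (p * r + p * r) - (q * r + q * r)

pencil₂ : ∀ b d → pencil 2 b d 0 ≡
  b 0F 0F * b 1F 1F - b 0F 1F * b 1F 0F
pencil₂ b d = arith (b 0F 0F) (b 0F 1F) (b 1F 0F) (b 1F 1F)
  (d 0F 0F) (d 0F 1F) (d 1F 0F) (d 1F 1F)
  where
  arith : ∀ x y z w e f g h →
    1ℤ * (x * (1ℤ * (w * 1ℤ + h * 0ℤ) + 0ℤ) + e * 0ℤ) +
    ((- 1ℤ) * (y * (1ℤ * (z * 1ℤ + g * 0ℤ) + 0ℤ) + f * 0ℤ) + 0ℤ) ≡ x * w - y * z
  arith = solve-∀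

pencil₃ : ∀ b d → pencil 3 b d 0 ≡
  b 0F 0F * pencil 2 (minor 0F 0F b) (minor 0F 0F d) 0
  - b 0F 1F * pencil 2 (minor 0F 1F b) (minor 0F 1F d) 0
  + b 0F 2F * pencil 2 (minor 0F 2F b) (minor 0F 2F d) 0
pencil₃ b d = arith (b 0F 0F) (b 0F 1F) (b 0F 2F)
  (d 0F 0F) (d 0F 1F) (d 0F 2F) (m 0F) (m 1F) (m 2F)
  where
  m : Fin 3 → ℤ
  m j = pencil 2 (minor 0F j b) (minor 0F j d) 0
  arith : ∀ x y z e f g k l m →
    1ℤ * (x * k + e * 0ℤ) + ((- 1ℤ) * (y * l + f * 0ℤ) + (1ℤ * (z * m + g * 0ℤ) + 0ℤ)) ≡
    x * k - y * l + z * m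
  arith = solve-∀

pencil₄ : ∀ b d → pencil 4 b d 0 ≡
  b 0F 0F * pencil 3 (minor 0F 0F b) (minor 0F 0F d) 0
  - b 0F 1F * pencil 3 (minor 0F 1F b) (minor 0F 1F d) 0
  + b 0F 2F * pencil 3 (minor 0F 2F b) (minor 0F 2F d) 0
  - b 0F 3F *
      pencil 3 (minor 0F 3F b) (minor 0F 3F d) 0
pencil₄ b d = arith (b 0F 0F) (b 0F 1F) (b 0F 2F) (b 0F 3F)
  (d 0F 0F) (d 0F 1F) (d 0F 2F) (d 0F 3F)
  (m 0F) (m 1F) (m 2F) (m 3F)
  where
  m : Fin 4 → ℤ
  m j = pencil 3 (minor 0F j b) (minor 0F j d) 0
  arith : ∀ x y z w e f g h k l m n →
    1ℤ * (x * k + e * 0ℤ) + ((- 1ℤ) * (y * l + f * 0ℤ) +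
      (1ℤ * (z * m + g * 0ℤ) + ((- 1ℤ) * (w * n + h * 0ℤ) + 0ℤ))) ≡
    x * k - y * l + z * m - w * n
  arith = solve-∀

det₂ : Matrix 2 → ℤ
det₂ b = b 0F 0F * b 1F 1F - b 0F 1F * b 1F 0F

det₃ : Matrix 3 → ℤ
det₃ b = b 0F 0F * det₂ (minor 0F 0F b) - b 0F 1F * det₂ (minor 0F 1F b) + b 0F 2F * det₂ (minor 0F 2F b)

pencil₃-det₃ : ∀ b d → pencil 3 b d 0 ≡ det₃ b
pencil₃-det₃ b d = trans (pencil₃ b d)
  (cong₂ _+_ (cong₂ _-_ (cong (b 0F 0F *_) (pencil₂ (minor 0F 0F b) (minor 0F 0F d))) (cong (b 0F 1F *_) (pencil₂ (minor 0F 1F b) (minor 0F 1F d))))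
    (cong (b 0F 2F *_) (pencil₂ (minor 0F 2F b) (minor 0F 2F d))))

det₄ : Matrix 4 → ℤ
det₄ b = b 0F 0F * det₃ (minor 0F 0F b) - b 0F 1F * det₃ (minor 0F 1F b)
  + b 0F 2F * det₃ (minor 0F 2F b)
  - b 0F 3F * det₃ (minor 0F 3F b)

pencil₄-det₄ : ∀ b d → pencil 4 b d 0 ≡ det₄ b
pencil₄-det₄ b d = trans (pencil₄ b d)
  (cong₂ _-_ (cong₂ _+_ (cong₂ _-_
    (cong (b 0F 0F *_) (pencil₃-det₃ (minor 0F 0F b) (minor 0F 0F d))) (cong (b 0F 1F *_) (pencil₃-det₃ (minor 0F 1F b) (minor 0F 1F d))))
    (cong (b 0F 2F *_) (pencil₃-det₃ (minor 0F 2F b) (minor 0F 2F d))))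
    (cong (b 0F 3F *_) (pencil₃-det₃ (minor 0F 3F b) (minor 0F 3F d))))

hollow : (x y z u v w : ℤ) → Matrix 4
hollow x y z u v w i j = lookup (lookup
  ((0ℤ ∷ x ∷ y ∷ z ∷ []) ∷
   (x ∷ 0ℤ ∷ u ∷ v ∷ []) ∷
   (y ∷ u ∷ 0ℤ ∷ w ∷ []) ∷
   (z ∷ v ∷ w ∷ 0ℤ ∷ []) ∷ []) i) j

det₄-hollow : ∀ x y z u v w → det₄ (hollow x y z u v w) ≡ Δ (x * w) (y * v) (z * u)
det₄-hollow = expanded
  where
  expanded : ∀ x y z u v w →
    0ℤ * (0ℤ * (0ℤ * 0ℤ - w * w) - u * (u * 0ℤ - w * v) + v * (u * w - 0ℤ * v))
      - x * (x * (0ℤ * 0ℤ - w * w) - u * (y * 0ℤ - w * z) + v * (y * w - 0ℤ * z))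
      + y * (x * (u * 0ℤ - w * v) - 0ℤ * (y * 0ℤ - w * z) + v * (y * v - u * z))
      - z * (x * (u * w - 0ℤ * v) - 0ℤ * (y * w - 0ℤ * z) + u * (y * v - u * z)) ≡
    x * w * (x * w) + y * v * (y * v) + z * u * (z * u) - (x * w * (y * v) + x * w * (y * v))
      - (x * w * (z * u) + x * w * (z * u)) - (y * v * (z * u) + y * v * (z * u))
  expanded = solve-∀

Δ-cong : ∀ {p p' q q' r r'} → p ≡ p' → q ≡ q' → r ≡ r' → Δ p q r ≡ Δ p' q' r'
Δ-cong refl refl refl = refl

Δ-swap₁₂ : ∀ p q r → Δ p q r ≡ Δ q p r
Δ-swap₁₂ = expanded
  where
  expanded : ∀ p q r →
    p * p + q * q + r * r - (p * q + p * q) - (p * r + p * r) - (q * r + q * r) ≡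
    q * q + p * p + r * r - (q * p + q * p) - (q * r + q * r) - (p * r + p * r)
  expanded = solve-∀

Δ-swap₂₃ : ∀ p q r → Δ p q r ≡ Δ p r q
Δ-swap₂₃ = expanded
  where
  expanded : ∀ p q r →
    p * p + q * q + r * r - (p * q + p * q) - (p * r + p * r) - (q * r + q * r) ≡
    p * p + r * r + q * q - (p * r + p * r) - (p * q + p * q) - (r * q + r * q)
  expanded = solve-∀

-- For p = 0 the form `Δ` collapses to the square (q - r)².
Δ-zero : ∀ q → Δ 0ℤ q q ≡ 0ℤ
Δ-zero = expanded
  where
  expanded : ∀ q →
    0ℤ * 0ℤ + q * q + q * q - (0ℤ * q + 0ℤ * q) - (0ℤ * q + 0ℤ * q) - (q * q + q * q) ≡ 0ℤ
  expanded = solve-∀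

-- Fourfold sums and the trace identity for symmetric matrices with zero diagonal

∑₂ : ∀ {n} → (Fin n → Fin n → ℤ) → ℤ
∑₂ f = sum λ x → sum λ y → f x y

∑₂-cong : ∀ {n} {f g : Fin n → Fin n → ℤ} → (∀ x y → f x y ≡ g x y) → ∑₂ f ≡ ∑₂ g
∑₂-cong h = sum-cong-≗ λ x → sum-cong-≗ (h x)

∑₂-+ : ∀ {n} (f g : Fin n → Fin n → ℤ) → ∑₂ (λ x y → f x y + g x y) ≡ ∑₂ f + ∑₂ g
∑₂-+ f g = trans (sum-cong-≗ λ x → ∑-distrib-+ (f x) (g x)) (∑-distrib-+ (λ x → sum (f x)) (λ x → sum (g x)))

∑₄ : ∀ {n} → (Fin n → Fin n → Fin n → Fin n → ℤ) → ℤ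
∑₄ f = ∑₂ λ x y → ∑₂ λ z w → f x y z w

∑₄-cong : ∀ {n} {f g : Fin n → Fin n → Fin n → Fin n → ℤ} →
  (∀ x y z w → f x y z w ≡ g x y z w) → ∑₄ f ≡ ∑₄ g
∑₄-cong h = ∑₂-cong λ x y → ∑₂-cong (h x y)

∑₄-+ : ∀ {n} (f g : Fin n → Fin n → Fin n → Fin n → ℤ) →
  ∑₄ (λ x y z w → f x y z w + g x y z w) ≡ ∑₄ f + ∑₄ g
∑₄-+ f g = trans (∑₂-cong λ x y → ∑₂-+ (f x y) (g x y))
  (∑₂-+ (λ x y → ∑₂ (f x y)) (λ x y → ∑₂ (g x y)))

∑₄-swap₃₄ : ∀ {n} (f : Fin n → Fin n → Fin n → Fin n → ℤ) → ∑₄ f ≡ ∑₄ λ x y z w → f x y w z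
∑₄-swap₃₄ f = ∑₂-cong λ x y → ∑-comm (f x y)

∑₄-swap₂₃ : ∀ {n} (f : Fin n → Fin n → Fin n → Fin n → ℤ) → ∑₄ f ≡ ∑₄ λ x y z w → f x z y w
∑₄-swap₂₃ f = sum-cong-≗ λ x → ∑-comm λ y z → sum (f x y z)

sum-* : ∀ {m n} (f : Fin m → ℤ) (g : Fin n → ℤ) → sum f * sum g ≡ sum λ i → sum λ j → f i * g j
sum-* f g = trans (*-distribʳ-sum (sum g) f) (sum-cong-≗ λ i → *-distribˡ-sum (f i) g)

∑₂-*ˡ : ∀ {n} c (f : Fin n → Fin n → ℤ) → c * ∑₂ f ≡ ∑₂ λ x y → c * f x y
∑₂-*ˡ c f = trans (*-distribˡ-sum c (λ x → sum (f x))) (sum-cong-≗ λ x → *-distribˡ-sum c (f x))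

∑₂-* : ∀ {n} (f g : Fin n → Fin n → ℤ) → ∑₂ f * ∑₂ g ≡ ∑₄ λ x y z w → f x y * g z w
∑₂-* f g = trans (ℤ.*-comm (∑₂ f) (∑₂ g)) (trans (∑₂-*ˡ (∑₂ g) f)
  (∑₂-cong λ x y → trans (ℤ.*-comm (∑₂ g) (f x y)) (∑₂-*ˡ (f x y) g)))

-- The sum of the squared entries of A², which is tr A⁴ for symmetric A.
closed4Walks : ∀ {n} → Matrix n → ℤ
closed4Walks A = ∑₂ λ x w → (sum λ y → A x y * A y w) * (sum λ z → A x z * A z w)

module HollowSymmetric {n : ℕ} (A : Matrix n)
  (A-sym : ∀ x y → A x y ≡ A y x) (A-diag : ∀ x → A x x ≡ 0ℤ) where

  open Tagged A

  matchingΔ : (a b c d : Fin n) → ℤ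
  matchingΔ a b c d = Δ (A a b * A c d) (A a c * A b d) (A a d * A b c)

  principalMinor₄ : ∀ a b c d → principalMinor (a ∷ b ∷ c ∷ d ∷ []) ≡ matchingΔ a b c d
  principalMinor₄ a b c d = trans (tagged-pencil t 0) (trans
    (pencil-cong 4 {entries t} {H} {tags t} same (λ _ _ → refl) 0)
    (trans (pencil₄-det₄ H (tags t)) (det₄-hollow (A a b) (A a c) (A a d) (A b c) (A b d) (A c d))))
    where
    t : Vec (Fin n × Bool) 4
    t = fixed (a ∷ b ∷ c ∷ d ∷ [])
    H : Matrix 4
    H = hollow (A a b) (A a c) (A a d) (A b c) (A b d) (A c d)
    same : ∀ i j → entries t i j ≡ H i j
    same 0F 0F = A-diag a
    same 0F 1F = refl
    same 0F 2F = refl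
    same 0F 3F = refl
    same 1F 0F = A-sym b a
    same 1F 1F = A-diag b
    same 1F 2F = refl
    same 1F 3F = refl
    same 2F 0F = A-sym c a
    same 2F 1F = A-sym c b
    same 2F 2F = A-diag c
    same 2F 3F = refl
    same 3F 0F = A-sym d a
    same 3F 1F = A-sym d b
    same 3F 2F = A-sym d c
    same 3F 3F = A-diag d

  -- Transposing two vertices permutes the three matchings. If two vertices coincide, one matching
  -- uses a diagonal entry and the other two have equal products, which is the situation of
  -- `Δ-zero`.
  principalMinor-symmetric : SymmetricOffDiagonal 4 principalMinor
  principalMinor-symmetric =
    (λ { a b (c ∷ d ∷ []) → via (swap₁₂ a b c d) }) ,
    (λ { a (c ∷ d ∷ []) → trans (principalMinor₄ a a c d) (diag₁₂ a c d) }) , λ a →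
    (λ { b c (d ∷ []) → via (swap₂₃ a b c d) }) ,
    (λ { b (d ∷ []) → trans (principalMinor₄ a b b d) (trans (swap₁₂ a b b d)
      (trans (swap₂₃ b a b d) (diag₁₂ b a d))) }) , λ b →
    (λ { c d [] → via (swap₃₄ a b c d) }) ,
    (λ { c [] → trans (principalMinor₄ a b c c) (trans (swap₂₃ a b c c) (trans (swap₃₄ a c b c)
      (trans (swap₁₂ a c c b) (trans (swap₂₃ c a c b) (diag₁₂ c a b))))) }) , λ _ → tt
    where
    via : ∀ {a b c d a' b' c' d'} → matchingΔ a b c d ≡ matchingΔ a' b' c' d' →
      principalMinor (a ∷ b ∷ c ∷ d ∷ []) ≡ principalMinor (a' ∷ b' ∷ c' ∷ d' ∷ [])
    via {a} {b} {c} {d} {a'} {b'} {c'} {d'} eq =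
      trans (principalMinor₄ a b c d) (trans eq (sym (principalMinor₄ a' b' c' d')))
    swap₁₂ : ∀ a b c d → matchingΔ a b c d ≡ matchingΔ b a c d
    swap₁₂ a b c d = trans (Δ-swap₂₃ (A a b * A c d) (A a c * A b d) (A a d * A b c))
      (Δ-cong (cong (_* A c d) (A-sym a b)) (ℤ.*-comm (A a d) (A b c)) (ℤ.*-comm (A a c) (A b d)))
    swap₂₃ : ∀ a b c d → matchingΔ a b c d ≡ matchingΔ a c b d
    swap₂₃ a b c d = trans (Δ-swap₁₂ (A a b * A c d) (A a c * A b d) (A a d * A b c))
      (Δ-cong (refl {x = A a c * A b d}) (refl {x = A a b * A c d}) (cong (A a d *_) (A-sym b c)))
    swap₃₄ : ∀ a b c d → matchingΔ a b c d ≡ matchingΔ a b d c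
    swap₃₄ a b c d = trans (Δ-swap₂₃ (A a b * A c d) (A a c * A b d) (A a d * A b c))
      (Δ-cong (cong (A a b *_) (A-sym c d)) (refl {x = A a d * A b c}) (refl {x = A a c * A b d}))
    diag₁₂ : ∀ a c d → matchingΔ a a c d ≡ 0ℤ
    diag₁₂ a c d = trans
      (Δ-cong (trans (cong (_* A c d) (A-diag a)) (ℤ.*-zeroˡ (A c d))) (refl {x = A a c * A a d}) (ℤ.*-comm (A a d) (A a c)))
      (Δ-zero (A a c * A a d))

  tupleSum-allFin : tupleSum 4 principalMinor (Vec.allFin n) ≡ ∑₄ matchingΔ
  tupleSum-allFin = ∑₄-cong λ x y z w → trans
    (principalMinor₄ (ℓ x) (ℓ y) (ℓ z) (ℓ w))
    (trans (cong₂ (λ x y → matchingΔ x y (ℓ z) (ℓ w)) (lookup-allFin x) (lookup-allFin y))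
      (cong₂ (matchingΔ x y) (lookup-allFin z) (lookup-allFin w)))
    where
    ℓ : Fin n → Fin n
    ℓ = lookup (Vec.allFin n)

  pairs : (x y z w : Fin n) → ℤ
  pairs x y z w = A x y * A z w * (A x y * A z w)

  walks : (x y z w : Fin n) → ℤ
  walks x y z w = A x y * A z w * (A x z * A y w)

  ∑-pairs : ∑₄ pairs ≡ ∑₂ (λ x y → A x y * A x y) * ∑₂ (λ x y → A x y * A x y)
  ∑-pairs = trans (∑₄-cong λ x y z w → regroup (A x y) (A z w))
    (sym (∑₂-* (λ x y → A x y * A x y) (λ x y → A x y * A x y)))
    where
    regroup : ∀ p q → p * q * (p * q) ≡ p * p * (q * q)
    regroup = solve-∀

  ∑-walks : ∑₄ walks ≡ closed4Walks A
  ∑-walks = begin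
    ∑₄ walks                       ≡⟨ ∑₄-swap₃₄ walks ⟩
    ∑₄ (λ x y w z → walks x y z w) ≡⟨ ∑₄-swap₂₃ (λ x y w z → walks x y z w) ⟩
    ∑₄ (λ x w y z → walks x y z w)
      ≡⟨ ∑₄-cong (λ x w y z → regroup (A x y) (A z w) (A x z) (A y w)) ⟩
    ∑₄ (λ x w y z → A x y * A y w * (A x z * A z w))
      ≡⟨ ∑₂-cong (λ x w → sym (sum-* (λ y → A x y * A y w) (λ z → A x z * A z w))) ⟩
    closed4Walks A ∎
    where
    open ≡-Reasoning
    regroup : ∀ p q r s → p * q * (r * s) ≡ p * s * (r * q)
    regroup = solve-∀

  private
    -- The remaining cross products and squares. Permuting the last three indices permutes the three
    -- matchings, so each of these has the same total as `walks` or `pairs`.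
    walks₂ walks₃ pairs₂ pairs₃ : (x y z w : Fin n) → ℤ
    walks₂ x y z w = walks x y w z
    walks₃ x y z w = walks₂ x z y w
    pairs₂ x y z w = pairs x z y w
    pairs₃ x y z w = pairs₂ x y w z

  ∑-matchingΔ : ∑₄ matchingΔ + fromℕ 6 * closed4Walks A ≡
    fromℕ 3 * (∑₂ (λ x y → A x y * A x y) * ∑₂ (λ x y → A x y * A x y))
  ∑-matchingΔ = begin
    ∑₄ matchingΔ + fromℕ 6 * closed4Walks A
      ≡⟨ six (∑₄ matchingΔ) (closed4Walks A) ⟩
    ∑₄ matchingΔ + (W + (W + W)) + (W + (W + W))
      ≡⟨ cong (λ z → ∑₄ matchingΔ + z + z) (sym sum-walks) ⟩
    ∑₄ matchingΔ + ∑₄ V + ∑₄ V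
      ≡⟨ cong (_+ ∑₄ V) (sym (∑₄-+ matchingΔ V)) ⟩
    ∑₄ (λ x y z w → matchingΔ x y z w + V x y z w) + ∑₄ V
      ≡⟨ sym (∑₄-+ (λ x y z w → matchingΔ x y z w + V x y z w) V) ⟩
    ∑₄ (λ x y z w → matchingΔ x y z w + V x y z w + V x y z w)
      ≡⟨ ∑₄-cong pointwise ⟩
    ∑₄ (λ x y z w → pairs x y z w + (pairs₂ x y z w + pairs₃ x y z w))
      ≡⟨ trans (∑₄-+ pairs (λ x y z w → pairs₂ x y z w + pairs₃ x y z w))
           (cong (∑₄ pairs +_) (∑₄-+ pairs₂ pairs₃)) ⟩
    ∑₄ pairs + (∑₄ pairs₂ + ∑₄ pairs₃)
      ≡⟨ cong₂ (λ p q → ∑₄ pairs + (p + q)) (sym (∑₄-swap₂₃ pairs))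
           (trans (sym (∑₄-swap₃₄ pairs₂)) (sym (∑₄-swap₂₃ pairs))) ⟩
    ∑₄ pairs + (∑₄ pairs + ∑₄ pairs)
      ≡⟨ cong (λ p → p + (p + p)) ∑-pairs ⟩
    D² + (D² + D²)
      ≡⟨ three D² ⟩
    fromℕ 3 * D² ∎
    where
    open ≡-Reasoning
    W D² : ℤ
    W = closed4Walks A
    D² = ∑₂ (λ x y → A x y * A x y) * ∑₂ (λ x y → A x y * A x y)
    -- The three cross products. They enter `Δ` with coefficient -2, so adding them twice leaves the
    -- squares alone.
    V : (x y z w : Fin n) → ℤ
    V x y z w = walks x y z w + (walks₂ x y z w + walks₃ x y z w)
    six : ∀ m w → m + fromℕ 6 * w ≡ m + (w + (w + w)) + (w + (w + w))
    six = arith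
      where
      arith : ∀ m w → m + ((1ℤ + (1ℤ + 1ℤ)) + (1ℤ + (1ℤ + 1ℤ))) * w ≡ m + (w + (w + w)) + (w + (w + w))
      arith = solve-∀
    three : ∀ d → d + (d + d) ≡ fromℕ 3 * d
    three = arith
      where
      arith : ∀ d → d + (d + d) ≡ (1ℤ + (1ℤ + 1ℤ)) * d
      arith = solve-∀
    sum-walks : ∑₄ V ≡ W + (W + W)
    sum-walks = trans (∑₄-+ walks (λ x y z w → walks₂ x y z w + walks₃ x y z w))
      (cong₂ _+_ ∑-walks (trans (∑₄-+ walks₂ walks₃) (cong₂ _+_
        (trans (sym (∑₄-swap₃₄ walks)) ∑-walks)
        (trans (sym (∑₄-swap₂₃ walks₂)) (trans (sym (∑₄-swap₃₄ walks)) ∑-walks)))))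
    pointwise : ∀ x y z w → matchingΔ x y z w + V x y z w + V x y z w ≡
      pairs x y z w + (pairs₂ x y z w + pairs₃ x y z w)
    pointwise x y z w = trans
      (cong (λ v → matchingΔ x y z w + v + v) (cong (walks x y z w +_) (cong₂ _+_
        (cong (λ t → A x y * t * (A x w * A y z)) (A-sym w z))
        (cong₂ (λ s t → A x z * s * (A x w * t)) (A-sym w y) (A-sym z y)))))
      (arith (A x y * A z w) (A x z * A y w) (A x w * A y z))
      where
      arith : ∀ p q r →
        p * p + q * q + r * r - (p * q + p * q) - (p * r + p * r) - (q * r + q * r)
        + (p * q + (p * r + q * r)) + (p * q + (p * r + q * r)) ≡ p * p + (q * q + r * r)
      arith = solve-∀

-- The trace identity for the characteristic polynomial of a graph

adjℤ-sym : ∀ {n} (G : Graph n) x y → adjℤ G x y ≡ adjℤ G y x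
adjℤ-sym G x y = cong (if_then 1ℤ else 0ℤ) (Graph.sym G x y)

adjℤ-diag : ∀ {n} (G : Graph n) x → adjℤ G x x ≡ 0ℤ
adjℤ-diag G x = cong (if_then 1ℤ else 0ℤ) (Graph.irrefl G x)

coeff-charPoly : ∀ {n} (G : Graph n) k →
  coeff k (charPoly G) ≡ pencil n (λ x y → - adjℤ G x y) δ k
coeff-charPoly {n} G = coeff-det n _ (λ x y → - adjℤ G x y) δ entry
  where
  entry : ∀ i j → LinearEntry
    ((if does (i Fin.≟ j) then 0ℤ ∷ 1ℤ ∷ [] else []) +ₚ (- adjℤ G i j ∷ [])) (- adjℤ G i j) (δ i j)
  entry i j with does (i Fin.≟ j)
  ... | true  = subst (λ a → LinearEntry (a ∷ 1ℤ ∷ []) (- adjℤ G i j) 1ℤ)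
                  (sym (ℤ.+-identityˡ (- adjℤ G i j))) (linear-entry (- adjℤ G i j) 1ℤ)
  ... | false = constant-entry (- adjℤ G i j)

degreeSum : ∀ {n} → Graph n → ℤ
degreeSum G = ∑₂ (adjℤ G)

a₄-closed4Walks : ∀ {n} (G : Graph n) →
  fromℕ 24 * a₄ G + fromℕ 6 * closed4Walks (adjℤ G) ≡ fromℕ 3 * (degreeSum G * degreeSum G)
a₄-closed4Walks {n} G = begin
  fromℕ 24 * a₄ G + fromℕ 6 * closed4Walks (adjℤ G)
    ≡⟨ cong₂ (λ s t → fromℕ 24 * s + fromℕ 6 * t) a₄-subseqSum (sym walks-neg) ⟩
  fromℕ 24 * subseqSum 4 principalMinor (Vec.allFin n) + fromℕ 6 * closed4Walks A
    ≡⟨ cong (_+ fromℕ 6 * closed4Walks A) (trans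
         (factorial*subseqSum 4 principalMinor principalMinor-symmetric (Vec.allFin n)) tupleSum-allFin) ⟩
  ∑₄ matchingΔ + fromℕ 6 * closed4Walks A
    ≡⟨ ∑-matchingΔ ⟩
  fromℕ 3 * (∑₂ (λ x y → A x y * A x y) * ∑₂ (λ x y → A x y * A x y))
    ≡⟨ cong (λ d → fromℕ 3 * (d * d)) (∑₂-cong squares) ⟩
  fromℕ 3 * (degreeSum G * degreeSum G) ∎
  where
  open ≡-Reasoning
  -- The constant part of λ I - A(G) is the negated adjacency matrix; the sign disappears again from
  -- both traces, where entries occur in even numbers.
  A : Matrix n
  A x y = - adjℤ G x y
  open Tagged A
  open HollowSymmetric A (λ x y → cong -_ (adjℤ-sym G x y)) (λ x → cong -_ (adjℤ-diag G x))
  walks-neg : closed4Walks A ≡ closed4Walks (adjℤ G)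
  walks-neg = ∑₂-cong λ x w → cong (λ k → k * k)
    (sum-cong-≗ λ y → neg-neg-* (adjℤ G x y) (adjℤ G y w))
  squares : ∀ x y → A x y * A x y ≡ adjℤ G x y
  squares x y with adj G x y
  ... | true  = refl
  ... | false = refl
  lookup-free : ∀ i → lookup (free (Vec.allFin n)) i ≡ (i , true)
  lookup-free i = trans (lookup-map i (_, true) (Vec.allFin n)) (cong (_, true) (lookup-allFin i))
  charPoly-tagged : ∀ k → coeff k (charPoly G) ≡ tagged (free (Vec.allFin n)) k
  charPoly-tagged k = trans (coeff-charPoly G k) (trans
    (pencil-cong n {A} {entries (free (Vec.allFin n))} {δ} {tags (free (Vec.allFin n))}
      (λ i j → cong₂ (λ s t → A (proj₁ s) (proj₁ t)) (sym (lookup-free i)) (sym (lookup-free j)))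
      (λ i j → cong (λ t → if proj₂ t then δ i j else 0ℤ) (sym (lookup-free i))) k)
    (sym (tagged-pencil (free (Vec.allFin n)) k)))
  a₄-subseqSum : a₄ G ≡ subseqSum 4 principalMinor (Vec.allFin n)
  a₄-subseqSum with 4 ℕ.≤? n
  ... | yes 4≤n = trans (cong (if_then coeff (n ℕ.∸ 4) (charPoly G) else 0ℤ) (dec-true (4 ℕ.≤? n) 4≤n))
    (trans (charPoly-tagged (n ℕ.∸ 4)) (tagged-fourth (Vec.allFin n) (n ℕ.∸ 4) (ℕ.m∸n+n≡m 4≤n)))
  -- With fewer than four vertices `aCoeff` takes its default value 0, and there is no 4-subset to
  -- sum over.
  ... | no 4≰n = trans (cong (if_then coeff (n ℕ.∸ 4) (charPoly G) else 0ℤ) (dec-false (4 ℕ.≤? n) 4≰n))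
    (sym (subseqSum-short 4 principalMinor (Vec.allFin n) (ℕ.≰⇒> 4≰n)))

-- Order of sums and spreading of squares

sum-mono-≤ : ∀ {n} {f g : Fin n → ℤ} → (∀ i → f i ℤ.≤ g i) → sum f ℤ.≤ sum g
sum-mono-≤ {zero}  h = ℤ.≤-refl
sum-mono-≤ {suc n} h = ℤ.+-mono-≤ (h zero) (sum-mono-≤ (h ∘ suc))

sum-mono-< : ∀ {n} {f g : Fin n → ℤ} → (∀ i → f i ℤ.≤ g i) → ∀ i → f i ℤ.< g i → sum f ℤ.< sum g
sum-mono-< h zero    lt = ℤ.+-mono-<-≤ lt (sum-mono-≤ (h ∘ suc))
sum-mono-< h (suc i) lt = ℤ.+-mono-≤-< (h zero) (sum-mono-< (h ∘ suc) i lt)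

+-cancelʳ-≡ : ∀ {x y} c → x + c ≡ y + c → x ≡ y
+-cancelʳ-≡ {x} {y} c eq = trans (sym (undo x c)) (trans (cong (_- c) eq) (undo y c))
  where
  undo : ∀ x c → x + c - c ≡ x
  undo = solve-∀

+-cancelʳ-≤ : ∀ {x y} c → x + c ℤ.≤ y + c → x ℤ.≤ y
+-cancelʳ-≤ {x} {y} c h with x ℤ.≤? y
... | yes x≤y = x≤y
... | no x≰y  = ⊥-elim (ℤ.<⇒≱ (ℤ.+-monoˡ-< c (ℤ.≰⇒> x≰y)) h)

+-cancelʳ-< : ∀ {x y} c → x + c ℤ.< y + c → x ℤ.< y
+-cancelʳ-< {x} {y} c h with x ℤ.<? y
... | yes x<y = x<y
... | no x≮y  = ⊥-elim (ℤ.≤⇒≯ (ℤ.+-monoˡ-≤ c (ℤ.≮⇒≥ x≮y)) h)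

sum-exchange : ∀ {n} {u v : Fin n} → u ≢ v → (f g : Fin n → ℤ) →
  (∀ i → i ≢ u → i ≢ v → f i ≡ g i) → sum f + (g u + g v) ≡ sum g + (f u + f v)
sum-exchange {suc zero} {zero} {zero} u≢v f g h = ⊥-elim (u≢v refl)
sum-exchange {suc (suc n)} {u} {v} u≢v f g h = begin
  sum f + (g u + g v)                 ≡⟨ cong (_+ (g u + g v)) (split f) ⟩
  f u + (f v + rest f) + (g u + g v)  ≡⟨ cong (λ r → f u + (f v + r) + (g u + g v)) same-rest ⟩
  f u + (f v + rest g) + (g u + g v)  ≡⟨ swap (f u) (f v) (rest g) (g u) (g v) ⟩
  g u + (g v + rest g) + (f u + f v)  ≡⟨ cong (_+ (f u + f v)) (sym (split g)) ⟩
  sum g + (f u + f v)                 ∎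
  where
  open ≡-Reasoning
  v' : Fin (suc n)
  v' = punchOut u≢v
  rest : (Fin (suc (suc n)) → ℤ) → ℤ
  rest f = sum (λ i → f (punchIn u (punchIn v' i)))
  split : ∀ f → sum f ≡ f u + (f v + rest f)
  split f = trans (sum-remove {i = u} f) (cong (f u +_) (trans (sum-remove {i = v'} (f ∘ punchIn u))
    (cong (λ i → f i + rest f) (Fin.punchIn-punchOut u≢v))))
  same-rest : rest f ≡ rest g
  same-rest = sum-cong-≗ λ i → h _ (Fin.punchInᵢ≢i u _) λ eq → Fin.punchInᵢ≢i v' i
    (Fin.punchIn-injective u _ _ (trans eq (sym (Fin.punchIn-punchOut u≢v))))
  swap : ∀ a b r c d → a + (b + r) + (c + d) ≡ c + (d + r) + (a + b)
  swap = solve-∀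

-- With d = a + b - c, the gain c² + d² - a² - b² is 2 (a - c)(b - c), which is positive as soon as
-- c lies below both a and b.
squares-identity : ∀ a b c d → a + b ≡ c + d →
  a * a + b * b + ((a - c) * (b - c) + (a - c) * (b - c)) ≡ c * c + d * d
squares-identity a b c d eq = subst (λ d → _ ≡ c * c + d * d) (trans (cong (_- c) eq) (cancel c d)) (arith a b c)
  where
  cancel : ∀ c d → c + d - c ≡ d
  cancel = solve-∀
  arith : ∀ a b c → a * a + b * b + ((a - c) * (b - c) + (a - c) * (b - c)) ≡ c * c + (a + b - c) * (a + b - c)
  arith = solve-∀

squares-spread : ∀ a b c d → a + b ≡ c + d → c ℤ.≤ a → c ℤ.≤ b →
  a * a + b * b ℤ.≤ c * c + d * d
squares-spread a b c d eq c≤a c≤b = subst₂ ℤ._≤_ (ℤ.+-identityʳ _) (squares-identity a b c d eq)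
  (ℤ.+-monoʳ-≤ (a * a + b * b) (ℤ.+-mono-≤ pq≥0 pq≥0))
  where
  instance
    q≥0 : ℤ.NonNegative (b - c)
    q≥0 = ℤ.nonNegative (ℤ.i≤j⇒0≤j-i c≤b)
  pq≥0 : 0ℤ ℤ.≤ (a - c) * (b - c)
  pq≥0 = subst (ℤ._≤ (a - c) * (b - c)) (ℤ.*-zeroˡ (b - c)) (ℤ.*-monoʳ-≤-nonNeg (b - c) (ℤ.i≤j⇒0≤j-i c≤a))

squares-spread-strict : ∀ a b c d → a + b ≡ c + d → c ℤ.< a → c ℤ.< b →
  a * a + b * b ℤ.< c * c + d * d
squares-spread-strict a b c d eq c<a c<b = subst₂ ℤ._<_ (ℤ.+-identityʳ _) (squares-identity a b c d eq)
  (ℤ.+-monoʳ-< (a * a + b * b) (ℤ.+-mono-< pq>0 pq>0))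
  where
  i<j⇒0<j-i : ∀ {i j} → i ℤ.< j → 0ℤ ℤ.< j - i
  i<j⇒0<j-i {i} {j} i<j = subst (ℤ._< j - i) (ℤ.+-inverseʳ i) (ℤ.+-monoˡ-< (- i) i<j)
  instance
    q>0 : ℤ.Positive (b - c)
    q>0 = ℤ.positive (i<j⇒0<j-i c<b)
  pq>0 : 0ℤ ℤ.< (a - c) * (b - c)
  pq>0 = subst (ℤ._< (a - c) * (b - c)) (ℤ.*-zeroˡ (b - c)) (ℤ.*-monoʳ-<-pos (b - c) (i<j⇒0<j-i c<a))

-- Compression of two rows of a 0/1 matrix

⟦_⟧ : Bool → ℤ
⟦ b ⟧ = if b then 1ℤ else 0ℤ

Row : ℕ → Set
Row n = Fin n → Bool

_∩_ _∪_ : ∀ {n} → Row n → Row n → Row n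
(α ∩ β) y = α y ∧ β y
(α ∪ β) y = α y ∨ β y

-- The size of the intersection, written as an inner product so that it is additive in each row.
_∙_ : ∀ {n} → Row n → Row n → ℤ
α ∙ β = sum λ y → ⟦ α y ⟧ * ⟦ β y ⟧

∙-comm : ∀ {n} (α β : Row n) → α ∙ β ≡ β ∙ α
∙-comm α β = sum-cong-≗ λ y → ℤ.*-comm ⟦ α y ⟧ ⟦ β y ⟧

⟦⟧-modular : ∀ a b → ⟦ a ⟧ + ⟦ b ⟧ ≡ ⟦ a ∧ b ⟧ + ⟦ a ∨ b ⟧
⟦⟧-modular true  true  = refl
⟦⟧-modular true  false = refl
⟦⟧-modular false true  = refl
⟦⟧-modular false false = refl

∙-modular : ∀ {n} (α β w : Row n) → α ∙ w + β ∙ w ≡ (α ∩ β) ∙ w + (α ∪ β) ∙ w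
∙-modular α β w = trans (sym (∑-distrib-+ (λ y → ⟦ α y ⟧ * ⟦ w y ⟧) (λ y → ⟦ β y ⟧ * ⟦ w y ⟧)))
  (trans (sum-cong-≗ λ y → trans (sym (ℤ.*-distribʳ-+ ⟦ w y ⟧ ⟦ α y ⟧ ⟦ β y ⟧))
      (trans (cong (_* ⟦ w y ⟧) (⟦⟧-modular (α y) (β y))) (ℤ.*-distribʳ-+ ⟦ w y ⟧ ⟦ α y ∧ β y ⟧ ⟦ α y ∨ β y ⟧)))
    (∑-distrib-+ (λ y → ⟦ α y ∧ β y ⟧ * ⟦ w y ⟧) (λ y → ⟦ α y ∨ β y ⟧ * ⟦ w y ⟧)))

0≤1 : 0ℤ ℤ.≤ 1ℤ
0≤1 = ℤ.+≤+ ℕ.z≤n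

0<1 : 0ℤ ℤ.< 1ℤ
0<1 = ℤ.+<+ (ℕ.s≤s ℕ.z≤n)

∧-≤ˡ : ∀ a b w → ⟦ a ∧ b ⟧ * ⟦ w ⟧ ℤ.≤ ⟦ a ⟧ * ⟦ w ⟧
∧-≤ˡ true  true  w     = ℤ.≤-refl
∧-≤ˡ true  false true  = 0≤1
∧-≤ˡ true  false false = ℤ.≤-refl
∧-≤ˡ false b     w     = ℤ.≤-refl

∧-≤ʳ : ∀ a b w → ⟦ a ∧ b ⟧ * ⟦ w ⟧ ℤ.≤ ⟦ b ⟧ * ⟦ w ⟧
∧-≤ʳ true  b     w     = ℤ.≤-refl
∧-≤ʳ false true  true  = 0≤1
∧-≤ʳ false true  false = ℤ.≤-refl
∧-≤ʳ false false w     = ℤ.≤-refl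

∩-≤ˡ : ∀ {n} (α β w : Row n) → (α ∩ β) ∙ w ℤ.≤ α ∙ w
∩-≤ˡ α β w = sum-mono-≤ λ y → ∧-≤ˡ (α y) (β y) (w y)

∩-≤ʳ : ∀ {n} (α β w : Row n) → (α ∩ β) ∙ w ℤ.≤ β ∙ w
∩-≤ʳ α β w = sum-mono-≤ λ y → ∧-≤ʳ (α y) (β y) (w y)

∩-<ˡ : ∀ {n} (α β : Row n) y → α y ≡ true → β y ≡ false → (α ∩ β) ∙ (α ∪ β) ℤ.< α ∙ (α ∪ β)
∩-<ˡ α β y αy βy = sum-mono-< (λ i → ∧-≤ˡ (α i) (β i) _) y strict
  where
  strict : ⟦ α y ∧ β y ⟧ * ⟦ α y ∨ β y ⟧ ℤ.< ⟦ α y ⟧ * ⟦ α y ∨ β y ⟧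
  strict rewrite αy | βy = 0<1

∩-<ʳ : ∀ {n} (α β : Row n) y → α y ≡ false → β y ≡ true → (α ∩ β) ∙ (α ∪ β) ℤ.< β ∙ (α ∪ β)
∩-<ʳ α β y αy βy = sum-mono-< (λ i → ∧-≤ʳ (α i) (β i) _) y strict
  where
  strict : ⟦ α y ∧ β y ⟧ * ⟦ α y ∨ β y ⟧ ℤ.< ⟦ β y ⟧ * ⟦ α y ∨ β y ⟧
  strict rewrite αy | βy = 0<1

sq : ℤ → ℤ
sq a = a * a

Rows : ℕ → Set
Rows n = Fin n → Row n

sharing : ∀ {n} → Rows n → ℤ
sharing R = ∑₂ λ x w → sq (R x ∙ R w)

compress : ∀ {n} → Fin n → Fin n → Rows n → Rows n
compress u v R x =
  if does (x Fin.≟ u) then R u ∩ R v else if does (x Fin.≟ v) then R u ∪ R v else R x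

module Compress {n} {u v : Fin n} (u≢v : u ≢ v) (R : Rows n) where

  R' : Rows n
  R' = compress u v R

  compress-u : R' u ≡ R u ∩ R v
  compress-u rewrite dec-true (u Fin.≟ u) refl = refl

  compress-v : R' v ≡ R u ∪ R v
  compress-v rewrite dec-false (v Fin.≟ u) (u≢v ∘ sym) | dec-true (v Fin.≟ v) refl = refl

  compress-other : ∀ x → x ≢ u → x ≢ v → R' x ≡ R x
  compress-other x x≢u x≢v rewrite dec-false (x Fin.≟ u) x≢u | dec-false (x Fin.≟ v) x≢v = refl

  private
    energy : Rows n → Row n → ℤ
    energy Q w = sum λ x → sq (Q x ∙ w)

    energy-exchange : ∀ w → energy R w + (sq ((R u ∩ R v) ∙ w) + sq ((R u ∪ R v) ∙ w)) ≡
      energy R' w + (sq (R u ∙ w) + sq (R v ∙ w))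
    energy-exchange w = trans
      (cong₂ (λ α β → energy R w + (sq (α ∙ w) + sq (β ∙ w))) (sym compress-u) (sym compress-v))
      (sum-exchange u≢v (λ x → sq (R x ∙ w)) (λ x → sq (R' x ∙ w))
        λ x x≢u x≢v → cong (λ α → sq (α ∙ w)) (sym (compress-other x x≢u x≢v)))

    energy-≤ : ∀ w → energy R w ℤ.≤ energy R' w
    energy-≤ w = +-cancelʳ-≤ (sq (R u ∙ w) + sq (R v ∙ w)) (subst (energy R w + (sq (R u ∙ w) + sq (R v ∙ w)) ℤ.≤_) (energy-exchange w)
      (ℤ.+-monoʳ-≤ (energy R w) (squares-spread (R u ∙ w) (R v ∙ w) ((R u ∩ R v) ∙ w) ((R u ∪ R v) ∙ w)
        (∙-modular (R u) (R v) w) (∩-≤ˡ (R u) (R v) w) (∩-≤ʳ (R u) (R v) w))))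

    -- Against the union the rows of `u` and `v` keep their full sizes, and the private elements `y`
    -- of `u` and `z` of `v` make both sizes exceed that of the intersection.
    energy-< : ∀ {y z} → R u y ≡ true → R v y ≡ false → R u z ≡ false → R v z ≡ true →
      energy R (R' v) ℤ.< energy R' (R' v)
    energy-< {y} {z} uy vy uz vz = subst (λ w → energy R w ℤ.< energy R' w) (sym compress-v)
      (+-cancelʳ-< (sq (R u ∙ w) + sq (R v ∙ w)) (subst (energy R w + (sq (R u ∙ w) + sq (R v ∙ w)) ℤ.<_) (energy-exchange w)
        (ℤ.+-monoʳ-< (energy R w)
          (squares-spread-strict (R u ∙ w) (R v ∙ w) ((R u ∩ R v) ∙ w) ((R u ∪ R v) ∙ w)
            (∙-modular (R u) (R v) w) (∩-<ˡ (R u) (R v) y uy vy) (∩-<ʳ (R u) (R v) z uz vz)))))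
      where
      w = R u ∪ R v

  -- Compression changes both arguments of the double sum, so they are exchanged one at a time
  -- through the mixed sum of the squares of `R' x ∙ R w`. The first exchange loses nothing; the
  -- second gains strictly at `w = v`, whose new row is the union.
  sharing-< : ∀ {y z} → R u y ≡ true → R v y ≡ false → R u z ≡ false → R v z ≡ true →
    sharing R ℤ.< sharing R'
  sharing-< uy vy uz vz = ℤ.≤-<-trans
    (subst₂ ℤ._≤_ (∑-comm (λ w x → sq (R x ∙ R w)))
      (sum-cong-≗ λ w → sum-cong-≗ λ x → cong sq (∙-comm (R' x) (R w)))
      (sum-mono-≤ λ w → energy-≤ (R w)))
    (subst₂ ℤ._<_ (∑-comm (λ w x → sq (R x ∙ R' w)))
      (sum-cong-≗ λ w → sum-cong-≗ λ x → cong sq (∙-comm (R' x) (R' w)))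
      (sum-mono-< (λ w → energy-≤ (R' w)) v (energy-< uy vy uz vz)))

  size-compress : ∑₂ (λ x y → ⟦ R' x y ⟧) ≡ ∑₂ (λ x y → ⟦ R x y ⟧)
  size-compress = sym (+-cancelʳ-≡ (size (R u) + size (R v))
    (trans (cong (sum (size ∘ R) +_) sizes)
      (sum-exchange u≢v (size ∘ R) (size ∘ R') λ x x≢u x≢v → cong size (sym (compress-other x x≢u x≢v)))))
    where
    size : Row n → ℤ
    size α = sum λ y → ⟦ α y ⟧
    sizes : size (R u) + size (R v) ≡ size (R' u) + size (R' v)
    sizes = trans (sym (∑-distrib-+ (λ y → ⟦ R u y ⟧) (λ y → ⟦ R v y ⟧)))
      (trans (sum-cong-≗ λ y → ⟦⟧-modular (R u y) (R v y))
      (trans (∑-distrib-+ (λ y → ⟦ R u y ∧ R v y ⟧) (λ y → ⟦ R u y ∨ R v y ⟧))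
        (cong₂ (λ α β → size α + size β) (sym compress-u) (sym compress-v))))

-- Bipartite graphs as rows of one class

-- R lists the neighbours of each vertex x with side x = true, and nothing for the other vertices.
record Orientation {n} (G : Graph n) (side : Fin n → Bool) (R : Rows n) : Set where
  field
    edge   : ∀ x y → adj G x y ≡ R x y ∨ R y x
    source : ∀ x y → R x y ≡ true → side x ≡ true
    target : ∀ x y → R x y ≡ true → side y ≡ false

true≢false : ∀ {b} → b ≡ true → b ≡ false → ⊥
true≢false refl ()

module Oriented {n} {G : Graph n} {side : Fin n → Bool} {R : Rows n} (or : Orientation G side R) where
  open Orientation or

  no-consecutive : ∀ x y z → R x y ≡ true → R y z ≡ true → ⊥
  no-consecutive x y z xy yz = true≢false (source y z yz) (target x y xy)

  degreeSum-size : degreeSum G ≡ ∑₂ (λ x y → ⟦ R x y ⟧) + ∑₂ (λ x y → ⟦ R x y ⟧)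
  degreeSum-size = begin
    ∑₂ (adjℤ G)
      ≡⟨ ∑₂-cong (λ x y → trans (cong ⟦_⟧ (edge x y)) (disjoint (R x y) (R y x) (no-consecutive x y x))) ⟩
    ∑₂ (λ x y → ⟦ R x y ⟧ + ⟦ R y x ⟧)
      ≡⟨ ∑₂-+ (λ x y → ⟦ R x y ⟧) (λ x y → ⟦ R y x ⟧) ⟩
    ∑₂ (λ x y → ⟦ R x y ⟧) + ∑₂ (λ x y → ⟦ R y x ⟧)
      ≡⟨ cong (∑₂ (λ x y → ⟦ R x y ⟧) +_) (∑-comm (λ x y → ⟦ R y x ⟧)) ⟩
    ∑₂ (λ x y → ⟦ R x y ⟧) + ∑₂ (λ x y → ⟦ R x y ⟧) ∎
    where
    open ≡-Reasoning
    disjoint : ∀ a b → (a ≡ true → b ≡ true → ⊥) → ⟦ a ∨ b ⟧ ≡ ⟦ a ⟧ + ⟦ b ⟧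
    disjoint true  true  h = ⊥-elim (h refl refl)
    disjoint true  false h = refl
    disjoint false true  h = refl
    disjoint false false h = refl

  -- A common neighbour of `x` and `w` is either a target of both or a source of both, and the side
  -- of `x` allows only one kind. Both kinds have the same total of squares: tr (R Rᵀ)² = tr (Rᵀ
  -- R)².
  closed4Walks-sharing : closed4Walks (adjℤ G) ≡ sharing R + sharing R
  closed4Walks-sharing = begin
    closed4Walks (adjℤ G)
      ≡⟨ ∑₂-cong (λ x w → trans (cong sq (codegree x w)) (sq-split (out x w) (into x w) (exclusive x w))) ⟩
    ∑₂ (λ x w → sq (out x w) + sq (into x w))
      ≡⟨ ∑₂-+ (λ x w → sq (out x w)) (λ x w → sq (into x w)) ⟩
    sharing R + ∑₂ (λ x w → sq (into x w))
      ≡⟨ cong (sharing R +_) into-sharing ⟩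
    sharing R + sharing R ∎
    where
    open ≡-Reasoning
    out into : Fin n → Fin n → ℤ
    out x w = R x ∙ R w
    into x w = sum λ y → ⟦ R y x ⟧ * ⟦ R y w ⟧
    products : ∀ a b c d → (a ≡ true → b ≡ true → ⊥) → (c ≡ true → d ≡ true → ⊥) →
      (a ≡ true → c ≡ true → ⊥) → (d ≡ true → b ≡ true → ⊥) →
      ⟦ a ∨ b ⟧ * ⟦ c ∨ d ⟧ ≡ ⟦ a ⟧ * ⟦ d ⟧ + ⟦ b ⟧ * ⟦ c ⟧
    products true  true  c     d     ab cd ac db = ⊥-elim (ab refl refl)
    products true  false true  d     ab cd ac db = ⊥-elim (ac refl refl)
    products true  false false true  ab cd ac db = refl
    products true  false false false ab cd ac db = refl
    products false true  c     true  ab cd ac db = ⊥-elim (db refl refl)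
    products false true  true  false ab cd ac db = refl
    products false true  false false ab cd ac db = refl
    products false false true  d     ab cd ac db = refl
    products false false false true  ab cd ac db = refl
    products false false false false ab cd ac db = refl
    codegree : ∀ x w → sum (λ y → adjℤ G x y * adjℤ G y w) ≡ out x w + into x w
    codegree x w = trans
      (sum-cong-≗ λ y → trans (cong₂ (λ s t → ⟦ s ⟧ * ⟦ t ⟧) (edge x y) (edge y w))
        (products (R x y) (R y x) (R y w) (R w y) (no-consecutive x y x) (no-consecutive y w y)
          (no-consecutive x y w) (no-consecutive w y x)))
      (∑-distrib-+ (λ y → ⟦ R x y ⟧ * ⟦ R w y ⟧) (λ y → ⟦ R y x ⟧ * ⟦ R y w ⟧))
    exclusive : ∀ x w → out x w ≡ 0ℤ ⊎ into x w ≡ 0ℤ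
    exclusive x w with side x in sx
    ... | false = inj₁ (sum-zero λ y → absent (R x y) ⟦ R w y ⟧ λ xy → true≢false (source x y xy) sx)
      where
      absent : ∀ a b → ¬ a ≡ true → ⟦ a ⟧ * b ≡ 0ℤ
      absent true  b h = ⊥-elim (h refl)
      absent false b h = ℤ.*-zeroˡ b
    ... | true = inj₂ (sum-zero λ y → absent (R y x) ⟦ R y w ⟧ λ yx → true≢false sx (target y x yx))
      where
      absent : ∀ a b → ¬ a ≡ true → ⟦ a ⟧ * b ≡ 0ℤ
      absent true  b h = ⊥-elim (h refl)
      absent false b h = ℤ.*-zeroˡ b
    sq-split : ∀ p q → p ≡ 0ℤ ⊎ q ≡ 0ℤ → sq (p + q) ≡ sq p + sq q
    sq-split p q (inj₁ refl) = trans (cong sq (ℤ.+-identityˡ q)) (sym (ℤ.+-identityˡ (sq q)))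
    sq-split p q (inj₂ refl) = trans (cong sq (ℤ.+-identityʳ p)) (sym (ℤ.+-identityʳ (sq p)))
    r : Fin n → Fin n → ℤ
    r x y = ⟦ R x y ⟧
    term : (x w y z : Fin n) → ℤ
    term x w y z = r y x * r y w * (r z x * r z w)
    into-sharing : ∑₂ (λ x w → sq (into x w)) ≡ sharing R
    into-sharing = begin
      ∑₂ (λ x w → sq (into x w))
        ≡⟨ ∑₂-cong (λ x w → sum-* (λ y → r y x * r y w) (λ z → r z x * r z w)) ⟩
      ∑₄ term
        ≡⟨ ∑₄-swap₂₃ term ⟩
      ∑₄ (λ x y w z → term x w y z)
        ≡⟨ ∑-comm (λ x y → ∑₂ λ w z → term x w y z) ⟩
      ∑₄ (λ y x w z → term x w y z)
        ≡⟨ ∑₄-swap₃₄ (λ y x w z → term x w y z) ⟩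
      ∑₄ (λ y x z w → term x w y z)
        ≡⟨ ∑₄-swap₂₃ (λ y x z w → term x w y z) ⟩
      ∑₄ (λ y z x w → term x w y z)
        ≡⟨ ∑₄-cong (λ y z x w → regroup (r y x) (r y w) (r z x) (r z w)) ⟩
      ∑₄ (λ y z x w → r y x * r z x * (r y w * r z w))
        ≡⟨ ∑₂-cong (λ y z → sym (sum-* (λ x → r y x * r z x) (λ w → r y w * r z w))) ⟩
      sharing R ∎
      where
      regroup : ∀ p q s t → p * q * (s * t) ≡ p * s * (q * t)
      regroup = solve-∀

sumFin-sum : ∀ k f → fromℕ (sumFin k f) ≡ sum (fromℕ ∘ f)
sumFin-sum zero    f = refl
sumFin-sum (suc k) f = trans (ℤ.pos-+ (f zero) _) (cong (fromℕ (f zero) +_) (sumFin-sum k (f ∘ suc)))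

handshake : ∀ {n} (G : Graph n) → fromℕ (edgeCount G) + fromℕ (edgeCount G) ≡ degreeSum G
handshake {n} G = begin
  fromℕ (edgeCount G) + fromℕ (edgeCount G)
    ≡⟨ cong (λ e → e + e) (trans (sumFin-sum n _) (sum-cong-≗ λ x → sumFin-sum n (λ y → e x y))) ⟩
  ∑₂ (λ x y → fromℕ (e x y)) + ∑₂ (λ x y → fromℕ (e x y))
    ≡⟨ cong (∑₂ (λ x y → fromℕ (e x y)) +_) (∑-comm (λ x y → fromℕ (e x y))) ⟩
  ∑₂ (λ x y → fromℕ (e x y)) + ∑₂ (λ x y → fromℕ (e y x))
    ≡⟨ sym (∑₂-+ (λ x y → fromℕ (e x y)) (λ x y → fromℕ (e y x))) ⟩
  ∑₂ (λ x y → fromℕ (e x y) + fromℕ (e y x))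
    ≡⟨ ∑₂-cong both ⟩
  degreeSum G ∎
  where
  open ≡-Reasoning
  e : Fin n → Fin n → ℕ
  e x y = if adj G x y then (if does (toℕ x ℕ.<? toℕ y) then 1 else 0) else 0
  both : ∀ x y → fromℕ (e x y) + fromℕ (e y x) ≡ adjℤ G x y
  both x y with ℕ.<-cmp (toℕ x) (toℕ y)
  ... | tri< x<y _ y≮x rewrite Graph.sym G y x | dec-true (toℕ x ℕ.<? toℕ y) x<y | dec-false (toℕ y ℕ.<? toℕ x) y≮x
    with adj G x y
  ...   | true  = refl
  ...   | false = refl
  both x y | tri> x≮y _ y<x rewrite Graph.sym G y x | dec-false (toℕ x ℕ.<? toℕ y) x≮y | dec-true (toℕ y ℕ.<? toℕ x) y<x
    with adj G x y
  ...   | true  = refl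
  ...   | false = refl
  both x y | tri≈ _ x≡y _ with refl ← Fin.toℕ-injective x≡y rewrite Graph.irrefl G x = refl

-- The compressed graph

T⇒true : ∀ {b} → T b → b ≡ true
T⇒true {true} _ = refl

true⇒T : ∀ {b} → b ≡ true → T b
true⇒T refl = tt

¬T⇒false : ∀ {b} → ¬ T b → b ≡ false
¬T⇒false {true}  h = ⊥-elim (h tt)
¬T⇒false {false} h = refl

∧-trueˡ : ∀ a {b} → a ∧ b ≡ true → a ≡ true
∧-trueˡ true _ = refl

∧-trueʳ : ∀ a {b} → a ∧ b ≡ true → b ≡ true
∧-trueʳ true h = h

∨-true : ∀ a {b} → a ∨ b ≡ true → a ≡ true ⊎ b ≡ true
∨-true true  _ = inj₁ refl
∨-true false h = inj₂ h

Adj-sym : ∀ {n} (G : Graph n) {x y} → Adj G x y → Adj G y x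
Adj-sym G {x} {y} = subst T (Graph.sym G x y)

Reach-trans : ∀ {n} {G : Graph n} {x y z} → Reach G x y → Reach G y z → Reach G x z
Reach-trans here       q = q
Reach-trans (step e p) q = step e (Reach-trans p q)

Crossing : ∀ {n} → Graph n → (u v c y z : Fin n) → Set
Crossing G u v c y z =
  Adj G u c × Adj G v c × Adj G u y × ¬ Adj G v y × Adj G v z × ¬ Adj G u z

-- Kelmans' compression: moving the private neighbours of u over to v.
module Shift {n} (G : Graph n) (connected : Connected G) (bipartite : Bipartite G)
  {u v c y z : Fin n} (crossing : Crossing G u v c y z) where

  private
    col : Fin n → Bool
    col = proj₁ bipartite

    proper : ∀ x y → Adj G x y → col x ≢ col y
    proper = proj₂ bipartite

    uc : Adj G u c
    uc = proj₁ crossing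
    vc : Adj G v c
    vc = proj₁ (proj₂ crossing)
    uy : Adj G u y
    uy = proj₁ (proj₂ (proj₂ crossing))
    ¬vy : ¬ Adj G v y
    ¬vy = proj₁ (proj₂ (proj₂ (proj₂ crossing)))
    vz : Adj G v z
    vz = proj₁ (proj₂ (proj₂ (proj₂ (proj₂ crossing))))
    ¬uz : ¬ Adj G u z
    ¬uz = proj₂ (proj₂ (proj₂ (proj₂ (proj₂ crossing))))

    u≢v : u ≢ v
    u≢v refl = ¬vy uy

  -- Sides are named relative to `u`, so that `u`, and through the common neighbour `c` also `v`,
  -- are sources whichever colour they carry.
  side : Fin n → Bool
  side x = does (col x Bool.≟ col u)

  R : Rows n
  R x y = side x ∧ adj G x y

  private
    opposite : ∀ {x y} → Adj G x y → side y ≡ not (side x)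
    opposite {x} {y} xy = cases (col x) (col y) (col u) (proper x y xy)
      where
      cases : ∀ a b k → a ≢ b → does (b Bool.≟ k) ≡ not (does (a Bool.≟ k))
      cases true  true  k     h = ⊥-elim (h refl)
      cases true  false true  h = refl
      cases true  false false h = refl
      cases false true  true  h = refl
      cases false true  false h = refl
      cases false false k     h = ⊥-elim (h refl)

    side-u : side u ≡ true
    side-u = dec-true (col u Bool.≟ col u) refl

    side-v : side v ≡ true
    side-v = trans (opposite (Adj-sym G vc)) (cong not (trans (opposite uc) (cong not side-u)))

    source-R : ∀ x y → R x y ≡ true → side x ≡ true
    source-R x y = ∧-trueˡ (side x)

    target-R : ∀ x y → R x y ≡ true → side y ≡ false
    target-R x y h = trans (opposite (true⇒T (∧-trueʳ (side x) h))) (cong not (source-R x y h))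

    edge-R : ∀ x y → adj G x y ≡ R x y ∨ R y x
    edge-R x y = trans (cases (adj G x y) (side x) (side y) (λ h → opposite (true⇒T h)))
      (cong (λ a → R x y ∨ (side y ∧ a)) (Graph.sym G x y))
      where
      cases : ∀ a s t → (a ≡ true → t ≡ not s) → a ≡ (s ∧ a) ∨ (t ∧ a)
      cases true  true  t h = refl
      cases true  false t h with refl ← h refl = refl
      cases false true  true  h = refl
      cases false true  false h = refl
      cases false false true  h = refl
      cases false false false h = refl

  orientation : Orientation G side R
  orientation = record { edge = edge-R ; source = source-R ; target = target-R }

  open Compress u≢v R

  private
    R'-cases : ∀ x y → R' x y ≡ true →
      R x y ≡ true ⊎ x ≡ v × R u y ≡ true
    R'-cases x y h with x Fin.≟ u
    ... | yes refl = inj₁ (∧-trueˡ (R u y) h)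
    ... | no x≢u with x Fin.≟ v
    ...   | no x≢v = inj₁ h
    ...   | yes refl with ∨-true (R u y) h
    ...     | inj₁ uy = inj₂ (refl , uy)
    ...     | inj₂ vy = inj₁ vy

    source-R' : ∀ x y → R' x y ≡ true → side x ≡ true
    source-R' x y h with R'-cases x y h
    ... | inj₁ xy         = source-R x y xy
    ... | inj₂ (refl , _) = side-v

    target-R' : ∀ x y → R' x y ≡ true → side y ≡ false
    target-R' x y h with R'-cases x y h
    ... | inj₁ xy       = target-R x y xy
    ... | inj₂ (_ , uy) = target-R u y uy

  -- Only rows on the side of `u` are edited, and symmetrising them restores the other class. A loop
  -- would need a vertex that is both source and target.
  H : Graph n
  H = record
    { adj    = λ x y → R' x y ∨ R' y x
    ; sym    = λ x y → Bool.∨-comm (R' x y) (R' y x)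
    ; irrefl = λ x → loopless x (R' x x) refl
    }
    where
    loopless : ∀ x b → R' x x ≡ b → b ∨ b ≡ false
    loopless x true  h = ⊥-elim (true≢false (source-R' x x h) (target-R' x x h))
    loopless x false h = refl

  orientation' : Orientation H side R'
  orientation' = record { edge = λ _ _ → refl ; source = source-R' ; target = target-R' }

  H-bipartite : Bipartite H
  H-bipartite = side , λ x y xy eq → differ x y (T⇒true xy) eq
    where
    differ : ∀ x y → R' x y ∨ R' y x ≡ true → side x ≢ side y
    differ x y h eq with ∨-true (R' x y) h
    ... | inj₁ xy = true≢false (source-R' x y xy) (trans eq (target-R' x y xy))
    ... | inj₂ yx = true≢false (source-R' y x yx) (trans (sym eq) (target-R' y x yx))

  private
    H-adj : ∀ x y → R' x y ≡ true → Adj H x y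
    H-adj x y h = true⇒T (cong (_∨ R' y x) h)

    R-intro : ∀ {x y} → side x ≡ true → Adj G x y → R x y ≡ true
    R-intro sx xy = cong₂ _∧_ sx (T⇒true xy)

    join-adj : ∀ y → R u y ≡ true ⊎ R v y ≡ true → Adj H v y
    join-adj y h = H-adj v y (trans (cong (λ α → α y) compress-v) (either h))
      where
      either : R u y ≡ true ⊎ R v y ≡ true → R u y ∨ R v y ≡ true
      either (inj₁ uy) = cong (_∨ R v y) uy
      either (inj₂ vy) = trans (cong (R u y ∨_) vy) (Bool.∨-zeroʳ (R u y))

    meet-adj : ∀ y → R u y ≡ true → R v y ≡ true → Adj H u y
    meet-adj y uy vy = H-adj u y (trans (cong (λ α → α y) compress-u) (cong₂ _∧_ uy vy))

    Hvc : Adj H v c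
    Hvc = join-adj c (inj₂ (R-intro side-v vc))

    Huc : Adj H u c
    Huc = meet-adj c (R-intro side-u uc) (R-intro side-v vc)

    -- An edge u w lost by the compression is replaced by the path u c v w.
    Reach-edge : ∀ x w → R x w ≡ true → Reach H x w × Reach H w x
    Reach-edge x w xw with x Fin.≟ u
    ... | yes refl =
      step {w = c} Huc (step {w = v} (Adj-sym H {v} {c} Hvc) (step vw here)) ,
      step {w = v} (Adj-sym H {v} {w} vw) (step {w = c} Hvc (step (Adj-sym H {u} {c} Huc) here))
      where
      vw : Adj H v w
      vw = join-adj w (inj₁ xw)
    ... | no x≢u with x Fin.≟ v
    ...   | yes refl = step vw here , step (Adj-sym H {v} {w} vw) here
      where
      vw : Adj H v w
      vw = join-adj w (inj₂ xw)
    ...   | no x≢v = step xw' here , step (Adj-sym H {x} {w} xw') here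
      where
      xw' : Adj H x w
      xw' = H-adj x w (trans (cong (λ α → α w) (compress-other x x≢u x≢v)) xw)

    Reach-adj : ∀ x w → Adj G x w → Reach H x w
    Reach-adj x w xw with ∨-true (R x w) (trans (sym (edge-R x w)) (T⇒true xw))
    ... | inj₁ h = proj₁ (Reach-edge x w h)
    ... | inj₂ h = proj₂ (Reach-edge w x h)

    Reach-H : ∀ {x w} → Reach G x w → Reach H x w
    Reach-H here       = here
    Reach-H (step e p) = Reach-trans (Reach-adj _ _ e) (Reach-H p)

  H-connected : Connected H
  H-connected x w = Reach-H (connected x w)

  degreeSum-H : degreeSum H ≡ degreeSum G
  degreeSum-H = trans (Oriented.degreeSum-size orientation')
    (trans (cong₂ _+_ size-compress size-compress) (sym (Oriented.degreeSum-size orientation)))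

  -- `edgeCount` looks at pairs in increasing order, which compression does not respect; the
  -- comparison therefore passes through the degree sum, which is then halved.
  edgeCount-H : edgeCount H ≡ edgeCount G
  edgeCount-H = halve (ℤ.+-injective (trans (ℤ.pos-+ (edgeCount H) (edgeCount H))
    (trans (trans (handshake H) (trans degreeSum-H (sym (handshake G))))
      (sym (ℤ.pos-+ (edgeCount G) (edgeCount G))))))
    where
    halve : ∀ {a b} → a ℕ.+ a ≡ b ℕ.+ b → a ≡ b
    halve {a} {b} eq = ℕ.*-cancelˡ-≡ a b 2
      (trans (cong (a ℕ.+_) (ℕ.+-identityʳ a)) (trans eq (cong (b ℕ.+_) (sym (ℕ.+-identityʳ b)))))

  closed4Walks-< : closed4Walks (adjℤ G) ℤ.< closed4Walks (adjℤ H)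
  closed4Walks-< = subst₂ ℤ._<_
    (sym (Oriented.closed4Walks-sharing orientation)) (sym (Oriented.closed4Walks-sharing orientation'))
    (ℤ.+-mono-< more more)
    where
    more : sharing R ℤ.< sharing R'
    more = sharing-< (R-intro side-u uy) (R-absent v ¬vy) (R-absent u ¬uz) (R-intro side-v vz)
      where
      R-absent : ∀ x {y} → ¬ Adj G x y → R x y ≡ false
      R-absent x h = trans (cong (side x ∧_) (¬T⇒false h)) (Bool.∧-zeroʳ (side x))

  -- The combination 24 a₄ + 6 tr A⁴ depends on the degree sum alone and so agrees on `G` and `H`;
  -- more closed walks force a smaller `a₄`.
  a₄-decreases : ¬ a₄ G ℤ.≤ a₄ H
  a₄-decreases h = ℤ.<-irrefl
    (trans (a₄-closed4Walks G) (trans (cong (λ d → fromℕ 3 * (d * d)) (sym degreeSum-H)) (sym (a₄-closed4Walks H))))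
    (ℤ.+-mono-≤-< (ℤ.*-monoˡ-≤-nonNeg (fromℕ 24) h) (ℤ.*-monoˡ-<-pos (fromℕ 6) closed4Walks-<))

-- Nested neighbourhoods and the construction of weights

module Nested {n} (G : Graph n) (no-crossing : ∀ u v c y z → ¬ Crossing G u v c y z)
  (connected : Connected G) (bipartite : Bipartite G) where

  private
    col : Fin n → Bool
    col = proj₁ bipartite

    proper : ∀ x y → Adj G x y → col x ≢ col y
    proper = proj₂ bipartite

  nested : ∀ {u v c y z} → Adj G u c → Adj G v c → Adj G u y → ¬ Adj G v y → Adj G v z → Adj G u z
  nested {u} {v} {c} {y} {z} uc vc uy ¬vy vz =
    decidable-stable (T? (adj G u z)) λ ¬uz → no-crossing u v c y z (uc , vc , uy , ¬vy , vz , ¬uz)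

  Near : Fin n → Fin n → Set
  Near x z = x ≡ z ⊎ ∃ λ c → Adj G x c × Adj G z c

  -- For x ~ a ~ y ~ b ~ z, nestedness of the neighbourhoods of a and b yields a common neighbour of x and z.
  Near-step : ∀ {x a y z} → Adj G x a → Adj G a y → Near y z → Near x z
  Near-step {a = a} xa ay (inj₁ refl) = inj₂ (a , xa , Adj-sym G ay)
  Near-step {x} {a} {y} {z} xa ay (inj₂ (b , yb , zb)) with T? (adj G b x)
  ... | yes bx = inj₂ (b , Adj-sym G bx , zb)
  ... | no ¬bx = inj₂ (a , xa , Adj-sym G (nested ay (Adj-sym G yb) (Adj-sym G xa) ¬bx (Adj-sym G zb)))

  -- `Near-step` absorbs the edges of a walk two at a time, so at most one is left over, according
  -- to parity.
  near-or-next : ∀ {x z} → Reach G x z → Near x z ⊎ ∃ λ a → Adj G x a × Near a z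
  near-or-next here = inj₁ (inj₁ refl)
  near-or-next (step {w = a} xa p) with near-or-next p
  ... | inj₁ near            = inj₂ (a , xa , near)
  ... | inj₂ (y , ay , near) = inj₁ (Near-step xa ay near)

  Near-col : ∀ {x z} → Near x z → col x ≡ col z
  Near-col (inj₁ refl) = refl
  Near-col {x} {z} (inj₂ (c , xc , zc)) = both-differ (col x) (col z) (col c) (proper x c xc) (proper z c zc)
    where
    both-differ : ∀ a b k → a ≢ k → b ≢ k → a ≡ b
    both-differ true  true  k     p q = refl
    both-differ false false k     p q = refl
    both-differ true  false true  p q = ⊥-elim (p refl)
    both-differ true  false false p q = ⊥-elim (q refl)
    both-differ false true  true  p q = ⊥-elim (q refl)
    both-differ false true  false p q = ⊥-elim (p refl)

  -- A leftover edge would change the colour, while `Near` preserves it.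
  same-side-near : ∀ x z → col x ≡ col z → Near x z
  same-side-near x z eq with near-or-next (connected x z)
  ... | inj₁ near            = near
  ... | inj₂ (a , xa , near) = ⊥-elim (proper x a xa (trans eq (sym (Near-col near))))

  -- This frees `nested` from its common neighbour: equal colours provide one, unless the two
  -- vertices are equal.
  chain : ∀ {x x' y z} → col x ≡ col x' → Adj G x y → ¬ Adj G x' y → Adj G x' z → Adj G x z
  chain {x} {x'} eq xy ¬x'y x'z with same-side-near x x' eq
  ... | inj₁ refl            = ⊥-elim (¬x'y xy)
  ... | inj₂ (c , xc , x'c) = nested xc x'c xy ¬x'y x'z

  ⊆-nbhd? : ∀ x' x → Dec (∀ z → Adj G x' z → Adj G x z)
  ⊆-nbhd? x' x = Fin.all? λ z → T? (adj G x' z) →-dec T? (adj G x z)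

  -- If x ~ y, every vertex of the class of x missing y has a smaller neighbourhood than x, so
  -- missed y < lower x; otherwise every vertex counted by lower x misses y.
  lower missed : Fin n → ℤ
  lower x = sum λ x' → ⟦ col x' ∧ does (⊆-nbhd? x' x) ⟧
  missed y = sum λ x' → ⟦ col x' ∧ not (adj G x' y) ⟧

  ⟦⟧-mono : ∀ {a b} → (a ≡ true → b ≡ true) → ⟦ a ⟧ ℤ.≤ ⟦ b ⟧
  ⟦⟧-mono {true}  {true}  h = ℤ.≤-refl
  ⟦⟧-mono {true}  {false} h with () ← h refl
  ⟦⟧-mono {false} {true}  h = 0≤1
  ⟦⟧-mono {false} {false} h = ℤ.≤-refl

  adj⇒missed<lower : ∀ {x y} → col x ≡ true → Adj G x y → missed y ℤ.< lower x
  adj⇒missed<lower {x} {y} cx xy = sum-mono-< (λ x' → ⟦⟧-mono (included x')) x strict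
    where
    included : ∀ x' → col x' ∧ not (adj G x' y) ≡ true → col x' ∧ does (⊆-nbhd? x' x) ≡ true
    included x' h = cong₂ _∧_ cx' (dec-true (⊆-nbhd? x' x)
      λ z x'z → chain (trans cx (sym cx')) xy (λ x'y → true≢false (∧-trueʳ (col x') h) (cong not (T⇒true x'y))) x'z)
      where
      cx' : col x' ≡ true
      cx' = ∧-trueˡ (col x') h
    strict : ⟦ col x ∧ not (adj G x y) ⟧ ℤ.< ⟦ col x ∧ does (⊆-nbhd? x x) ⟧
    strict = subst₂ (λ a b → ⟦ a ⟧ ℤ.< ⟦ b ⟧)
      (sym (cong₂ (λ a b → a ∧ not b) cx (T⇒true xy)))
      (sym (cong₂ _∧_ cx (dec-true (⊆-nbhd? x x) λ z xz → xz))) 0<1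

  ¬adj⇒lower≤missed : ∀ {x y} → ¬ Adj G x y → lower x ℤ.≤ missed y
  ¬adj⇒lower≤missed {x} {y} ¬xy = sum-mono-≤ λ x' → ⟦⟧-mono (excluded x')
    where
    excluded : ∀ x' → col x' ∧ does (⊆-nbhd? x' x) ≡ true → col x' ∧ not (adj G x' y) ≡ true
    excluded x' h with ⊆-nbhd? x' x
    ... | yes x'⊆x = cong₂ _∧_ (∧-trueˡ (col x') h) (cong not (¬T⇒false (¬xy ∘ x'⊆x y)))
    ... | no x'⊈x  = ⊥-elim (true≢false (∧-trueʳ (col x') h) (dec-false (⊆-nbhd? x' x) x'⊈x))

  N : ℤ
  N = fromℕ n

  InRange : ℤ → Set
  InRange a = 0ℤ ℤ.≤ a × a ℤ.≤ N

  count-range : (p : Fin n → Bool) → InRange (sum λ x → ⟦ p x ⟧)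
  count-range p =
    subst (ℤ._≤ sum (λ x → ⟦ p x ⟧)) (sum-zero {n} (λ _ → refl)) (sum-mono-≤ {n} {λ _ → 0ℤ} (nonneg ∘ p)) ,
    subst (sum (λ x → ⟦ p x ⟧) ℤ.≤_) (sum-ones n) (sum-mono-≤ (≤-one ∘ p))
    where
    nonneg : ∀ b → 0ℤ ℤ.≤ ⟦ b ⟧
    nonneg true  = 0≤1
    nonneg false = ℤ.≤-refl
    ≤-one : ∀ b → ⟦ b ⟧ ℤ.≤ 1ℤ
    ≤-one true  = ℤ.≤-refl
    ≤-one false = 0≤1
    sum-ones : ∀ m → sum {m} (λ _ → 1ℤ) ≡ fromℕ m
    sum-ones zero    = refl
    sum-ones (suc m) = trans (cong (λ z → 1ℤ + z) (sum-ones m)) (sym (ℤ.pos-+ 1 m))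

  abs-diff-≤ : ∀ {a b} → InRange a → InRange b → fromℕ ℤ.∣ a - b ∣ ℤ.≤ N
  abs-diff-≤ {a} {b} (0≤a , a≤N) (0≤b , b≤N) = either (ℤ.≤-total b a)
    where
    ordered : ∀ {a b} → b ℤ.≤ a → 0ℤ ℤ.≤ b → a ℤ.≤ N → fromℕ ℤ.∣ a - b ∣ ℤ.≤ N
    ordered {a} {b} b≤a 0≤b a≤N = subst (ℤ._≤ N) (sym (ℤ.0≤i⇒+∣i∣≡i (ℤ.i≤j⇒0≤j-i b≤a)))
      (ℤ.≤-trans (ℤ.i-j≤i a b {{ℤ.nonNegative 0≤b}}) a≤N)
    either : b ℤ.≤ a ⊎ a ℤ.≤ b → fromℕ ℤ.∣ a - b ∣ ℤ.≤ N
    either (inj₁ b≤a) = ordered b≤a 0≤b a≤N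
    either (inj₂ a≤b) = subst (λ k → fromℕ k ℤ.≤ N) (ℤ.∣i-j∣≡∣j-i∣ b a) (ordered a≤b 0≤a b≤N)

  N-range : InRange N
  N-range = ℤ.+≤+ ℕ.z≤n , ℤ.≤-refl

  lower-range : ∀ x → InRange (lower x)
  lower-range x = count-range λ x' → col x' ∧ does (⊆-nbhd? x' x)

  missed-range : ∀ y → InRange (missed y)
  missed-range y = count-range λ x' → col x' ∧ not (adj G x' y)

  -- Weights lie in [0, N] on one class and in [-N, 0] on the other, so within a class they differ
  -- by at most N, below the threshold 1 + N. Across the classes the difference is N + `lower x` -
  -- `missed y`, which reaches 1 + N exactly when `missed y` is less than `lower x`, that is, when x
  -- and y are adjacent.
  weight : Fin n → ℤ
  weight v = if col v then lower v else missed v - N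

  weight-true : ∀ {v} → col v ≡ true → weight v ≡ lower v
  weight-true {v} = cong (if_then lower v else missed v - N)

  weight-false : ∀ {v} → col v ≡ false → weight v ≡ missed v - N
  weight-false {v} = cong (if_then lower v else missed v - N)

  N<1+N : N ℤ.< 1ℤ + N
  N<1+N = subst (ℤ._< 1ℤ + N) (ℤ.+-identityˡ N) (ℤ.+-monoˡ-< N 0<1)

  weight-bound : ∀ v → fromℕ ℤ.∣ weight v ∣ ℤ.< 1ℤ + N
  weight-bound v = ℤ.≤-<-trans bounded N<1+N
    where
    bounded : fromℕ ℤ.∣ weight v ∣ ℤ.≤ N
    bounded with col v
    ... | true  = subst (ℤ._≤ N) (sym (ℤ.0≤i⇒+∣i∣≡i (proj₁ (lower-range v)))) (proj₂ (lower-range v))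
    ... | false = abs-diff-≤ (missed-range v) N-range

  ≤N⇒≱1+N : ∀ {a} → a ℤ.≤ N → ¬ 1ℤ + N ℤ.≤ a
  ≤N⇒≱1+N a≤N 1+N≤a = ℤ.<-irrefl refl (ℤ.<-≤-trans N<1+N (ℤ.≤-trans 1+N≤a a≤N))

  Threshold : Fin n → Fin n → Set
  Threshold x y = (Adj G x y → 1ℤ + N ℤ.≤ fromℕ ℤ.∣ weight x - weight y ∣) ×
    (1ℤ + N ℤ.≤ fromℕ ℤ.∣ weight x - weight y ∣ → Adj G x y)

  threshold-same : ∀ {x y} → col x ≡ col y → fromℕ ℤ.∣ weight x - weight y ∣ ℤ.≤ N → Threshold x y
  threshold-same {x} {y} eq small = (λ xy → ⊥-elim (proper x y xy eq)) , λ large → ⊥-elim (≤N⇒≱1+N small large)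

  threshold-across : ∀ {x y} → col x ≡ true → col y ≡ false → Threshold x y
  threshold-across {x} {y} cx cy = large , small
    where
    gap : weight x - weight y ≡ lower x + (N - missed y)
    gap = trans (cong₂ _-_ (weight-true cx) (weight-false cy)) (rearrange (lower x) (missed y) N)
      where
      rearrange : ∀ l m k → l - (m - k) ≡ l + (k - m)
      rearrange = solve-∀
    large : Adj G x y → 1ℤ + N ℤ.≤ fromℕ ℤ.∣ weight x - weight y ∣
    large xy = subst (1ℤ + N ℤ.≤_) (sym (trans (cong (fromℕ ∘ ℤ.∣_∣) gap)
        (ℤ.0≤i⇒+∣i∣≡i (ℤ.≤-trans 0≤1+N reach)))) reach
      where
      cancel : ∀ m k → 1ℤ + m + (k - m) ≡ 1ℤ + k
      cancel = solve-∀
      reach : 1ℤ + N ℤ.≤ lower x + (N - missed y)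
      reach = subst (ℤ._≤ lower x + (N - missed y)) (cancel (missed y) N)
        (ℤ.+-monoˡ-≤ (N - missed y) (ℤ.i<j⇒suc[i]≤j (adj⇒missed<lower cx xy)))
      0≤1+N : 0ℤ ℤ.≤ 1ℤ + N
      0≤1+N = ℤ.≤-trans 0≤1 (ℤ.+-monoʳ-≤ 1ℤ (proj₁ N-range))
    small : 1ℤ + N ℤ.≤ fromℕ ℤ.∣ weight x - weight y ∣ → Adj G x y
    -- For a non-edge, 0 ≤ `missed y` - `lower x` ≤ N, so the gap N - (`missed y` - `lower x`) is a
    -- difference of two numbers in [0, N] and stays below the threshold.
    small far = decidable-stable (T? (adj G x y)) λ ¬xy → ≤N⇒≱1+N
      (subst (λ z → fromℕ ℤ.∣ z ∣ ℤ.≤ N) (trans (rearrange (lower x) (missed y) N) (sym gap))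
        (abs-diff-≤ N-range (ℤ.i≤j⇒0≤j-i (¬adj⇒lower≤missed ¬xy) ,
          ℤ.≤-trans (ℤ.i-j≤i (missed y) (lower x) {{ℤ.nonNegative (proj₁ (lower-range x))}}) (proj₂ (missed-range y)))))
      far
      where
      rearrange : ∀ l m k → k - (m - l) ≡ l + (k - m)
      rearrange = solve-∀

  threshold-sym : ∀ {x y} → Threshold x y → Threshold y x
  threshold-sym {x} {y} (f , g) =
    (λ yx → subst (λ k → 1ℤ + N ℤ.≤ fromℕ k) flip (f (Adj-sym G yx))) ,
    (λ far → Adj-sym G (g (subst (λ k → 1ℤ + N ℤ.≤ fromℕ k) (sym flip) far)))
    where
    flip : ℤ.∣ weight x - weight y ∣ ≡ ℤ.∣ weight y - weight x ∣
    flip = ℤ.∣i-j∣≡∣j-i∣ (weight x) (weight y)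

  threshold : ∀ x y → Threshold x y
  threshold x y = cases (col x) (col y) refl refl
    where
    cancel : ∀ a b k → a - k - (b - k) ≡ a - b
    cancel = solve-∀
    cases : ∀ a b → col x ≡ a → col y ≡ b → Threshold x y
    cases true  false cx cy = threshold-across cx cy
    cases false true  cx cy = threshold-sym {y} {x} (threshold-across cy cx)
    cases true  true  cx cy = threshold-same (trans cx (sym cy))
      (subst (λ z → fromℕ ℤ.∣ z ∣ ℤ.≤ N) (sym (cong₂ _-_ (weight-true cx) (weight-true cy)))
        (abs-diff-≤ (lower-range x) (lower-range y)))
    cases false false cx cy = threshold-same (trans cx (sym cy))
      (subst (λ z → fromℕ ℤ.∣ z ∣ ℤ.≤ N)
        (sym (trans (cong₂ _-_ (weight-false cx) (weight-false cy)) (cancel (missed x) (missed y) N)))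
        (abs-diff-≤ (missed-range x) (missed-range y)))

-- Rational weights and the conclusion

fromℤ-minus : ∀ a b → fromℤ a ℚ.- fromℤ b ≡ fromℤ (a - b)
fromℤ-minus a b = trans (cong (fromℤ a ℚ.+_) (neg b))
  (trans (cong (ℚ._/ 1) (cong₂ _+_ (ℤ.*-identityʳ a) (ℤ.*-identityʳ (- b)))) (ℚ.↥p/↧p≡p (fromℤ (a - b))))
  where
  neg : ∀ b → ℚ.- fromℤ b ≡ fromℤ (- b)
  neg (ℤ.+ zero)    = refl
  neg (ℤ.+ (suc _)) = refl
  neg ℤ.-[1+ _ ]    = refl

fromℤ-≤ : ∀ {a b} → a ℤ.≤ b → fromℤ a ℚ.≤ fromℤ b
fromℤ-≤ {a} {b} h = ℚ.*≤* (subst₂ ℤ._≤_ (sym (ℤ.*-identityʳ a)) (sym (ℤ.*-identityʳ b)) h)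

fromℤ-≤⁻¹ : ∀ {a b} → fromℤ a ℚ.≤ fromℤ b → a ℤ.≤ b
fromℤ-≤⁻¹ {a} {b} h = subst₂ ℤ._≤_ (ℤ.*-identityʳ a) (ℤ.*-identityʳ b) (ℚ.drop-*≤* h)

fromℤ-< : ∀ {a b} → a ℤ.< b → fromℤ a ℚ.< fromℤ b
fromℤ-< {a} {b} h = ℚ.*<* (subst₂ ℤ._<_ (sym (ℤ.*-identityʳ a)) (sym (ℤ.*-identityʳ b)) h)

nested⇒difference : ∀ {n} (G : Graph n) → (∀ u v c y z → ¬ Crossing G u v c y z) →
  Connected G → Bipartite G → DifferenceGraph G
nested⇒difference G no-crossing connected bipartite =
  fromℤ (1ℤ + N) , fromℤ ∘ weight , (λ v → fromℤ-< (weight-bound v)) , λ u v _ →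
    (λ uv → subst (λ q → fromℤ (1ℤ + N) ℚ.≤ ℚ.∣ q ∣) (sym (fromℤ-minus (weight u) (weight v)))
      (fromℤ-≤ (proj₁ (threshold u v) uv))) ,
    (λ far → proj₂ (threshold u v) (fromℤ-≤⁻¹
      (subst (λ q → fromℤ (1ℤ + N) ℚ.≤ ℚ.∣ q ∣) (fromℤ-minus (weight u) (weight v)) far)))
  where
  open Nested G no-crossing connected bipartite

optimal⇒no-crossing : ∀ {n m} (G : Graph n) → BipartiteOptimal n m G → ∀ u v c y z → ¬ Crossing G u v c y z
optimal⇒no-crossing G ((connected , bipartite , size) , optimal) u v c y z crossing =
  a₄-decreases (optimal H (H-connected , H-bipartite , trans edgeCount-H size))
  where
  open Shift G connected bipartite crossing

theorem3p5 : (n m : ℕ) → 1 ≤ n → 1 ≤ m → ∃ (λ (H : Graph n) → InB n m H) →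
    (G : Graph n) → BipartiteOptimal n m G → DifferenceGraph G
theorem3p5 n m _ _ _ G optimal@((connected , bipartite , _) , _) =
  nested⇒difference G (optimal⇒no-crossing G optimal) connected bipartite
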